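{- Let $s\ge 1$ be an integer, and for $k\ge 0$ let $S_k(s):=k\left(1+2^{k-1}+\cdots+s^{k-1}\right)$ (so $S_0(s)=0$). Then for all integers $m\geq 0$ we have $H_{2m}(S_k(s))=0$ and $$H_{2m+1}(S_k(s))=(-s^2)^{m+1}\prod_{\ell=1}^m\left(\frac{\ell^4(s^2-\ell^2)}{4(2\ell+1)(2\ell-1)}\right)^{2(m+1-\ell)},$$ and in particular, $H_{2m+1}(S_k(s))=0$ for $m\geq s$.
   Context: For a sequence $(c_0,c_1,\ldots)$ (indexed from $k=0$), $H_n(c_k)=\det\big(c_{i+j}\big)_{0\le i,j\le n}$; here the sequence is taken in the index $k$, with $s$ fixed. Empty products equal $1$. -}

module Defs where

open import Algebra.Bundles.Raw using (RawRing)
import Algebra.Definitions.RawSemiring as RawSemiringDefs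
open import Data.Fin.Base using (Fin; zero; suc; toℕ; punchIn)
open import Data.Integer.Base as ℤ using (+_)
open import Data.Nat.Base using (ℕ; zero; suc; _+_; _*_; _∸_; _^_; NonZero)
open import Data.Nat.Properties using (+-suc; m*n≢0)
open import Data.Rational.Base as ℚ using (ℚ; _/_)
open import Data.Vec.Functional using (Vector)
open import Level using (Level)
open import Relation.Binary.PropositionalEquality using (sym; subst)

module Determinant {c ℓ : Level} (R : RawRing c ℓ) where
  open RawRing R using (Carrier; 1#; -_; rawSemiring) renaming (_*_ to _·_)
  open RawSemiringDefs rawSemiring using (sum) renaming (_^_ to _^ᴿ_)

  Matrix : ℕ → Set c
  Matrix n = Vector (Vector Carrier n) n

  minor : {n : ℕ} → Matrix (suc n) → Fin (suc n) → Matrix n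
  minor M j i k = M (suc i) (punchIn j k)

  -- Laplace expansion along the first row.
  det : {n : ℕ} → Matrix n → Carrier
  det {zero}  M = 1#
  det {suc n} M = sum λ j → (- 1#) ^ᴿ toℕ j · (M zero j · det (minor M j))

  -- H n c is a determinant of order n + 1, with 0 ≤ i, j ≤ n.
  H : ℕ → (ℕ → Carrier) → Carrier
  H n c = det {suc n} λ i j → c (toℕ i + toℕ j)

open Determinant ℚ.+-*-rawRing public using (H)
open RawSemiringDefs ℚ.+-*-rawSemiring public using () renaming (product to ∏; _^_ to _^ℚ_)

fromℕ : ℕ → ℚ
fromℕ n = + n / 1

open RawSemiringDefs Data.Nat.Base.+-*-rawSemiring using () renaming (sum to ∑)

-- S s k = k (1 + 2 ^ (k - 1) + ⋯ + s ^ (k - 1)); the case k = 0 is split off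
-- because the exponent k - 1 is not a natural number there.
S : ℕ → ℕ → ℕ
S s zero    = 0
S s (suc k) = suc k * ∑ {s} λ i → suc (toℕ i) ^ k

2ℓ∸1≢0 : (ℓ : ℕ) → .{{NonZero ℓ}} → NonZero (2 * ℓ ∸ 1)
2ℓ∸1≢0 (suc i) = subst NonZero (sym (+-suc i (i + 0))) _

2ℓ+1≢0 : (ℓ : ℕ) → NonZero (2 * ℓ + 1)
2ℓ+1≢0 ℓ = subst NonZero (sym (+-suc (2 * ℓ) 0)) _

denominator≢0 : (ℓ : ℕ) → .{{NonZero ℓ}} → NonZero (4 * (2 * ℓ + 1) * (2 * ℓ ∸ 1))
denominator≢0 ℓ =
  m*n≢0 (4 * (2 * ℓ + 1)) (2 * ℓ ∸ 1) {{m*n≢0 4 (2 * ℓ + 1) {{_}} {{2ℓ+1≢0 ℓ}}}} {{2ℓ∸1≢0 ℓ}}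

-- The truncated 2ℓ ∸ 1 is the true 2ℓ - 1, since ℓ ≥ 1.
factor : (s ℓ : ℕ) → .{{NonZero ℓ}} → ℚ
factor s ℓ =
  _/_ (+ (ℓ ^ 4) ℤ.* (+ (s ^ 2) ℤ.- + (ℓ ^ 2)))
      (4 * (2 * ℓ + 1) * (2 * ℓ ∸ 1))
      {{denominator≢0 ℓ}}

{-# OPTIONS --safe #-}
-- Let L f = Σ_{r = 1}^{s} f′(r), the derivative being read off from f(r + ε) over the dual
-- numbers; then L(xᵏ) = S s k, so the Hankel matrix is the Gram matrix of L on the powers of x.
-- With Y = 2x - s - 1 and the rising products
--   u_k = (x)_k (s + 1 - x)_k   and   v_j = (x - s)_j (1 - x)_j,
-- all symmetric under x ↦ s + 1 - x, L kills u_k v_j by symmetry, while telescoping gives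
--   (k + j + 1) L(Y u_k v_j) = 2s (1 + s)_k k! (1 - s)_j j!.
-- Up to scaling this is the Hilbert matrix 1 / (k + j + 1), so a Legendre-type combination P_m of
-- u_0, …, u_m (a Wilson polynomial) is orthogonal to every xⁱ with i ≤ 2m. Replacing the last two
-- columns of the Hankel matrix by those of x P_m and P_m makes it block triangular, which yields
-- H_{2m} = 0 and expresses H_{2m+1} / H_{2m-1} through the norm L(x^{2m+1} P_m).
module Submission where

open import Defs
open import Algebra.Bundles using (CommutativeRing; Semiring)
import Algebra.Definitions.RawSemiring as RawSemiringDefs
open import Algebra.Morphism.Structures using (IsRingHomomorphism)
import Algebra.Properties.CommutativeMonoid.Sum as CommutativeMonoidSum
import Algebra.Properties.CommutativeSemigroup as CommutativeSemigroupProperties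
import Algebra.Properties.Ring as RingProperties
import Algebra.Properties.Semiring.Sum as SemiringSum
open import Data.Fin.Base as Fin using (Fin; zero; suc; toℕ; inject₁; punchIn; punchOut; opposite; fromℕ<)
open import Data.Fin.Induction using (<-weakInduction)
import Data.Fin.Permutation as Permutation
open import Data.Fin.Properties using (_≟_; punchInᵢ≢i; punchIn-injective; punchIn-punchOut; toℕ-inject₁; toℕ-fromℕ; toℕ-fromℕ<; toℕ<n; opposite-prop; <⇒≢; <⇒≤pred; ≤∧≢⇒<; suc-injective)
open import Data.Fin.Relation.Unary.Top using (view; ‵fromℕ; ‵inject₁)
open import Data.Integer.Base using (ℤ; +_; 0ℤ; 1ℤ; -1ℤ)
import Data.Integer.Properties as ℤ
open import Data.Integer.Tactic.RingSolver using (solve-∀)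
open import Data.Maybe.Base using (just; nothing)
open import Data.Nat.Base as ℕ using (ℕ; zero; suc; _<_; _≤_; s≤s; s<s⁻¹)
import Data.Nat.Properties as ℕ
import Data.Nat.Tactic.RingSolver as ℕ-Solver
open import Data.Product.Base using (∃; Σ-syntax; _×_; _,_; proj₁; proj₂)
open import Data.Rational.Base as ℚ using (ℚ; 0ℚ; 1ℚ; _/_)
import Data.Rational.Properties as ℚ
open import Data.Rational.Unnormalised.Base as ℚᵘ using (mkℚᵘ; *≡*)
import Data.Rational.Unnormalised.Properties as ℚᵘ
open import Data.Sum.Base using (_⊎_; inj₁; inj₂)
open import Data.Vec.Functional using (Vector; tail; updateAt; insertAt)
open import Data.Vec.Functional.Properties using (updateAt-updates; updateAt-minimal; insertAt-lookup)
open import Function.Base using (_∘_; const)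
open import Level using (Level; 0ℓ)
open import Relation.Binary.PropositionalEquality as ≡ using (_≡_; _≢_; _≗_)
open import Relation.Nullary using (yes; no; contradiction)
import Tactic.RingSolver as RingSolver
open import Tactic.RingSolver.Core.AlmostCommutativeRing using (AlmostCommutativeRing; fromCommutativeRing)

-- Symmetry is what makes P_m orthogonal to more powers than it has free coefficients. The v_j with
-- j ≤ m and the x v_j with j < m span the polynomials of degree at most 2m. The v_j pair to zero
-- with every combination of the u_k, so only m conditions are left for m + 1 coefficients. In
-- particular P_m, of degree 2m, is orthogonal to its own leading power: the form degenerates at
-- every odd size, which is why the determinants are followed two sizes at a time. The two families
-- belong together because a single antidifference serves both: one shift makes its boundary term
-- vanish at 0, the other at s. Polynomials are functions on the dual numbers over the integers, so
-- every moment identity is stated with its denominators cleared, and positive rising factorials are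
-- cancelled afterwards. Fractions enter only when the result is carried to the rationals.

-- Column indices under deletion of a column

punchIn-inject₁ : ∀ {n} (j : Fin (suc n)) k → punchIn (inject₁ j) (inject₁ k) ≡ inject₁ (punchIn j k)
punchIn-inject₁ zero    k       = ≡.refl
punchIn-inject₁ (suc j) zero    = ≡.refl
punchIn-inject₁ (suc j) (suc k) = ≡.cong suc (punchIn-inject₁ j k)

punchIn-fromℕ : ∀ {n} (j : Fin (suc n)) → punchIn (inject₁ j) (Fin.fromℕ n) ≡ Fin.fromℕ (suc n)
punchIn-fromℕ         zero    = ≡.refl
punchIn-fromℕ {suc n} (suc j) = ≡.cong suc (punchIn-fromℕ j)

-- Deleting one or the other of two neighbours leaves the same columns, except that the survivor of
-- the pair occupies the same slot. Hence the two minors agree when the neighbouring columns are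
-- equal.
punchIn-adjacent : ∀ {n} (c k : Fin n) →
  punchIn (inject₁ c) k ≡ punchIn (suc c) k ⊎
  (punchIn (inject₁ c) k ≡ suc c × punchIn (suc c) k ≡ inject₁ c)
punchIn-adjacent zero    zero    = inj₂ (≡.refl , ≡.refl)
punchIn-adjacent zero    (suc k) = inj₁ ≡.refl
punchIn-adjacent (suc c) zero    = inj₁ ≡.refl
punchIn-adjacent (suc c) (suc k) with punchIn-adjacent c k
... | inj₁ eq        = inj₁ (≡.cong suc eq)
... | inj₂ (eq , eq′) = inj₂ (≡.cong suc eq , ≡.cong suc eq′)

-- Lets an equality of neighbouring columns descend to minors: deleting a column outside the pair
-- cannot separate it.
punchIn⁻¹-adjacent : ∀ {n} (j : Fin (suc (suc n))) (c : Fin (suc n)) → j ≢ inject₁ c → j ≢ suc c →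
  Σ[ d ∈ Fin n ] punchIn j (inject₁ d) ≡ inject₁ c × punchIn j (suc d) ≡ suc c
punchIn⁻¹-adjacent zero zero j≢c _ = contradiction ≡.refl j≢c
punchIn⁻¹-adjacent zero (suc c) _ _ = c , ≡.refl , ≡.refl
punchIn⁻¹-adjacent (suc zero) zero _ j≢1+c = contradiction ≡.refl j≢1+c
punchIn⁻¹-adjacent {suc n} (suc (suc j)) zero _ _ = zero , ≡.refl , ≡.refl
punchIn⁻¹-adjacent {suc n} (suc j) (suc c) j≢c j≢1+c
  with d , eq , eq′ ← punchIn⁻¹-adjacent j c (j≢c ∘ ≡.cong suc) (j≢1+c ∘ ≡.cong suc)
  = suc d , ≡.cong suc eq , ≡.cong suc eq′

inject₁≢suc : ∀ {n} (c : Fin n) → inject₁ c ≢ suc c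
inject₁≢suc (suc c) = inject₁≢suc c ∘ suc-injective

-- Determinants as alternating multilinear functions of the columns

module DeterminantProperties {a ℓ : Level} (R : CommutativeRing a ℓ) where
  open CommutativeRing R hiding (zero)
  open Determinant rawRing using (Matrix; minor; det) public
  open RawSemiringDefs (Semiring.rawSemiring semiring) using () renaming (_^_ to _^ᴿ_)
  open SemiringSum semiring
    using (sum; sum-cong-≋; sum-init-last; sum-replicate-zero; ∑-distrib-+; *-distribˡ-sum)
  open RingProperties ring
    using (-1*x≈-x; -0#≈0#; +-inverseʳ-unique; -‿involutive)
  open CommutativeSemigroupProperties *-commutativeSemigroup using (x∙yz≈y∙xz)
  open import Relation.Binary.Reasoning.Setoid setoid

  private variable
    n : ℕ

  sign : Fin n → Carrier
  sign j = (- 1#) ^ᴿ toℕ j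

  sign-inject₁ : (j : Fin n) → sign (inject₁ j) ≈ sign j
  sign-inject₁ j = reflexive (≡.cong ((- 1#) ^ᴿ_) (toℕ-inject₁ j))

  sum-zero : {f : Vector Carrier n} → (∀ i → f i ≈ 0#) → sum f ≈ 0#
  sum-zero {n} f≈0 = trans (sum-cong-≋ f≈0) (sum-replicate-zero n)

  sum-adjacent-cancel : (f : Vector Carrier (suc n)) (c : Fin n) →
    f (inject₁ c) + f (suc c) ≈ 0# → (∀ j → j ≢ inject₁ c → j ≢ suc c → f j ≈ 0#) → sum f ≈ 0#
  sum-adjacent-cancel f zero cancel others = begin
    f zero + (f (suc zero) + sum (tail (tail f))) ≈⟨ +-assoc _ _ _ ⟨
    f zero + f (suc zero) + sum (tail (tail f))   ≈⟨ +-cong cancel (sum-zero λ j → others (suc (suc j)) (λ ()) (λ ())) ⟩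
    0# + 0#                                       ≈⟨ +-identityˡ 0# ⟩
    0#                                            ∎
  sum-adjacent-cancel f (suc c) cancel others = begin
    f zero + sum (tail f) ≈⟨ +-cong (others zero (λ ()) (λ ())) (sum-adjacent-cancel (tail f) c cancel λ j j≢c j≢1+c → others (suc j) (j≢c ∘ suc-injective) (j≢1+c ∘ suc-injective)) ⟩
    0# + 0#                ≈⟨ +-identityˡ 0# ⟩
    0#                     ∎

  laplace : Matrix (suc n) → Vector Carrier (suc n)
  laplace M j = sign j * (M zero j * det (minor M j))

  det-cong : {M N : Matrix n} → (∀ i j → M i j ≈ N i j) → det M ≈ det N
  det-cong {zero}  M≈N = refl
  det-cong {suc n} M≈N = sum-cong-≋ λ j → *-congˡ {sign j}
    (*-cong (M≈N zero j) (det-cong λ i k → M≈N (suc i) (punchIn j k)))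

  -- The three matrices are compared entrywise instead of being built by updating a column. In this
  -- form the hypotheses restrict to minors, at `punchOut j≢c` when the deleted column is not `c`;
  -- when it is `c`, the three minors coincide.
  det-linear : (M N P : Matrix n) (c : Fin n) (x y : Carrier) →
    (∀ i → P i c ≈ x * M i c + y * N i c) →
    (∀ i j → j ≢ c → M i j ≈ P i j × N i j ≈ P i j) →
    det P ≈ x * det M + y * det N
  det-linear {suc n} M N P c x y at-c others = begin
    sum (laplace P)                                             ≈⟨ sum-cong-≋ term ⟩
    sum (λ j → x * laplace M j + y * laplace N j)               ≈⟨ ∑-distrib-+ (λ j → x * laplace M j) (λ j → y * laplace N j) ⟩
    sum (λ j → x * laplace M j) + sum (λ j → y * laplace N j)   ≈⟨ +-cong (*-distribˡ-sum x (laplace M)) (*-distribˡ-sum y (laplace N)) ⟨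
    x * det M + y * det N ∎
    where
    factor-out : ∀ z s u d → s * (u * (z * d)) ≈ z * (s * (u * d))
    factor-out z s u d = trans (*-congˡ (x∙yz≈y∙xz u z d)) (x∙yz≈y∙xz s z (u * d))
    term : ∀ j → laplace P j ≈
                 x * laplace M j + y * laplace N j
    term j with j ≟ c
    ... | yes ≡.refl = begin
      laplace P j
        ≈⟨ *-congˡ (*-congʳ (at-c zero)) ⟩
      sign j * ((x * M zero j + y * N zero j) * det (minor P j))
        ≈⟨ *-congˡ (distribʳ _ _ _) ⟩
      sign j * (x * M zero j * det (minor P j) + y * N zero j * det (minor P j))
        ≈⟨ *-congˡ (+-cong (trans (*-assoc _ _ _) (*-congˡ (*-congˡ (minors proj₁)))) (trans (*-assoc _ _ _) (*-congˡ (*-congˡ (minors proj₂))))) ⟩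
      sign j * (x * (M zero j * det (minor M j)) + y * (N zero j * det (minor N j)))
        ≈⟨ distribˡ _ _ _ ⟩
      sign j * (x * (M zero j * det (minor M j))) + sign j * (y * (N zero j * det (minor N j)))
        ≈⟨ +-cong (x∙yz≈y∙xz _ x _) (x∙yz≈y∙xz _ y _) ⟩
      x * laplace M j + y * laplace N j ∎
      where
      minors : {Q : Matrix (suc n)} → (∀ {i k} → M i k ≈ P i k × N i k ≈ P i k → Q i k ≈ P i k) →
               det (minor P j) ≈ det (minor Q j)
      minors eq = det-cong λ i k → sym (eq (others (suc i) (punchIn j k) (punchInᵢ≢i j k)))
    ... | no j≢c = begin
      laplace P j
        ≈⟨ *-congˡ (*-congˡ (det-linear (minor M j) (minor N j) (minor P j) c′ x y at-c′ others′)) ⟩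
      sign j * (P zero j * (x * det (minor M j) + y * det (minor N j)))
        ≈⟨ *-congˡ (distribˡ _ _ _) ⟩
      sign j * (P zero j * (x * det (minor M j)) + P zero j * (y * det (minor N j)))
        ≈⟨ distribˡ _ _ _ ⟩
      sign j * (P zero j * (x * det (minor M j))) + sign j * (P zero j * (y * det (minor N j)))
        ≈⟨ +-cong (factor-out x _ _ _) (factor-out y _ _ _) ⟩
      x * (sign j * (P zero j * det (minor M j))) + y * (sign j * (P zero j * det (minor N j)))
        ≈⟨ +-cong (*-congˡ (*-congˡ (*-congʳ (proj₁ (others zero j j≢c))))) (*-congˡ (*-congˡ (*-congʳ (proj₂ (others zero j j≢c))))) ⟨
      x * laplace M j + y * laplace N j ∎
      where
      c′ = punchOut j≢c
      c′-in : punchIn j c′ ≡ c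
      c′-in = punchIn-punchOut j≢c
      at-c′ : ∀ i → minor P j i c′ ≈ x * minor M j i c′ + y * minor N j i c′
      at-c′ i rewrite c′-in = at-c (suc i)
      others′ : ∀ i k → k ≢ c′ → minor M j i k ≈ minor P j i k × minor N j i k ≈ minor P j i k
      others′ i k k≢c′ = others (suc i) (punchIn j k)
        λ eq → k≢c′ (punchIn-injective j k c′ (≡.trans eq (≡.sym c′-in)))

  -- In the expansion along the first row the terms of the two equal columns have equal minors and
  -- opposite signs. Every other minor again has two equal neighbouring columns, so induction
  -- applies.
  det-adjacent-equal : (M : Matrix (suc n)) (c : Fin n) → (∀ i → M i (inject₁ c) ≈ M i (suc c)) → det M ≈ 0#
  det-adjacent-equal {suc n} M c eq = sum-adjacent-cancel _ c cancel others
    where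
    minors : ∀ i k → minor M (inject₁ c) i k ≈ minor M (suc c) i k
    minors i k with punchIn-adjacent c k
    ... | inj₁ same        = reflexive (≡.cong (M (suc i)) same)
    ... | inj₂ (eq₁ , eq₂) rewrite eq₁ | eq₂ = sym (eq (suc i))
    cancel : sign (inject₁ c) * (M zero (inject₁ c) * det (minor M (inject₁ c))) +
             sign (suc c) * (M zero (suc c) * det (minor M (suc c))) ≈ 0#
    cancel = begin
      sign (inject₁ c) * (M zero (inject₁ c) * det (minor M (inject₁ c))) + sign (suc c) * X
        ≈⟨ +-cong (*-cong (sign-inject₁ c) (*-cong (eq zero) (det-cong minors))) (*-congʳ (-1*x≈-x (sign c))) ⟩
      sign c * X + - sign c * X ≈⟨ distribʳ X _ _ ⟨
      (sign c + - sign c) * X   ≈⟨ *-congʳ (-‿inverseʳ (sign c)) ⟩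
      0# * X                    ≈⟨ zeroˡ X ⟩
      0# ∎
      where X = M zero (suc c) * det (minor M (suc c))
    others : ∀ j → j ≢ inject₁ c → j ≢ suc c → laplace M j ≈ 0#
    others j j≢c j≢1+c with d , eq₁ , eq₂ ← punchIn⁻¹-adjacent j c j≢c j≢1+c = begin
      laplace M j ≈⟨ *-congˡ (*-congˡ (det-adjacent-equal (minor M j) d minor-eq)) ⟩
      sign j * (M zero j * 0#)              ≈⟨ *-congˡ (zeroʳ _) ⟩
      sign j * 0#                           ≈⟨ zeroʳ _ ⟩
      0# ∎
      where
      minor-eq : ∀ i → minor M j i (inject₁ d) ≈ minor M j i (suc d)
      minor-eq i rewrite eq₁ | eq₂ = eq (suc i)

  -- Polarisation: with the sum of the two columns in both positions the determinant vanishes.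
  -- Expanding it leaves the two orders of the pair, because the terms with a repeated column vanish
  -- as well.
  det-adjacent-swap : (M N : Matrix (suc n)) (c : Fin n) →
    (∀ i → N i (inject₁ c) ≈ M i (suc c)) → (∀ i → N i (suc c) ≈ M i (inject₁ c)) →
    (∀ i j → j ≢ inject₁ c → j ≢ suc c → N i j ≈ M i j) → det N ≈ - det M
  det-adjacent-swap {n} M N c eq₁ eq₂ others = +-inverseʳ-unique _ _ (begin
    det M + det N                                ≈⟨ +-cong (det-cong W-M) (det-cong W-N) ⟨
    det (W p q) + det (W q p)                    ≈⟨ +-cong (trans (+-congʳ (W-equal p)) (+-identityˡ _)) (trans (+-congˡ (W-equal q)) (+-identityʳ _)) ⟨
    (det (W p p) + det (W p q)) + (det (W q p) + det (W q q))
                                                 ≈⟨ +-cong (W-linearʳ p) (W-linearʳ q) ⟨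
    det (W p p+q) + det (W q p+q)                ≈⟨ W-linearˡ p+q ⟨
    det (W p+q p+q)                              ≈⟨ W-equal p+q ⟩
    0# ∎)
    where
    p q p+q : Vector Carrier (suc n)
    p i = M i (inject₁ c)
    q i = M i (suc c)
    p+q i = p i + q i
    W : (u v : Vector Carrier (suc n)) → Matrix (suc n)
    W u v i = updateAt (updateAt (M i) (inject₁ c) (const (u i))) (suc c) (const (v i))
    W-inject₁ : ∀ u v i → W u v i (inject₁ c) ≡ u i
    W-inject₁ u v i = ≡.trans (updateAt-minimal (inject₁ c) (suc c) _ (inject₁≢suc c)) (updateAt-updates (inject₁ c) (M i))
    W-suc : ∀ u v i → W u v i (suc c) ≡ v i
    W-suc u v i = updateAt-updates (suc c) (updateAt (M i) (inject₁ c) (const (u i)))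
    W-other : ∀ u v i j → j ≢ inject₁ c → j ≢ suc c → W u v i j ≡ M i j
    W-other u v i j j≢c j≢1+c = ≡.trans (updateAt-minimal j (suc c) _ j≢1+c) (updateAt-minimal j (inject₁ c) (M i) j≢c)
    W-equal : ∀ u → det (W u u) ≈ 0#
    W-equal u = det-adjacent-equal (W u u) c λ i → reflexive (≡.trans (W-inject₁ u u i) (≡.sym (W-suc u u i)))
    W-≈ : ∀ u v (Q : Matrix (suc n)) → (∀ i → Q i (inject₁ c) ≈ u i) → (∀ i → Q i (suc c) ≈ v i) →
          (∀ i j → j ≢ inject₁ c → j ≢ suc c → Q i j ≈ M i j) → ∀ i j → W u v i j ≈ Q i j
    W-≈ u v Q at-c at-1+c elsewhere i j with j ≟ inject₁ c | j ≟ suc c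
    ... | yes ≡.refl | _          = trans (reflexive (W-inject₁ u v i)) (sym (at-c i))
    ... | no _       | yes ≡.refl = trans (reflexive (W-suc u v i)) (sym (at-1+c i))
    ... | no j≢c     | no j≢1+c   = trans (reflexive (W-other u v i j j≢c j≢1+c)) (sym (elsewhere i j j≢c j≢1+c))
    W-M : ∀ i j → W p q i j ≈ M i j
    W-M = W-≈ p q M (λ _ → refl) (λ _ → refl) (λ _ _ _ _ → refl)
    W-N : ∀ i j → W q p i j ≈ N i j
    W-N = W-≈ q p N eq₁ eq₂ others
    1*+1* : ∀ x y → 1# * x + 1# * y ≈ x + y
    1*+1* x y = +-cong (*-identityˡ x) (*-identityˡ y)
    W-linearʳ : ∀ u → det (W u p+q) ≈ det (W u p) + det (W u q)
    W-linearʳ u = trans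
      (det-linear (W u p) (W u q) (W u p+q) (suc c) 1# 1#
        (λ i → trans (reflexive (W-suc u p+q i)) (sym (trans (1*+1* _ _) (+-cong (reflexive (W-suc u p i)) (reflexive (W-suc u q i))))))
        (λ i j j≢1+c → agree p i j j≢1+c , agree q i j j≢1+c))
      (1*+1* _ _)
      where
      agree : ∀ v i j → j ≢ suc c → W u v i j ≈ W u p+q i j
      agree v i j j≢1+c = reflexive (≡.trans (updateAt-minimal j (suc c) _ j≢1+c) (≡.sym (updateAt-minimal j (suc c) _ j≢1+c)))
    W-linearˡ : ∀ v → det (W p+q v) ≈ det (W p v) + det (W q v)
    W-linearˡ v = trans
      (det-linear (W p v) (W q v) (W p+q v) (inject₁ c) 1# 1#
        (λ i → trans (reflexive (W-inject₁ p+q v i)) (sym (trans (1*+1* _ _) (+-cong (reflexive (W-inject₁ p v i)) (reflexive (W-inject₁ q v i))))))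
        (λ i j j≢c → agree p i j j≢c , agree q i j j≢c))
      (1*+1* _ _)
      where
      agree : ∀ u i j → j ≢ inject₁ c → W u v i j ≈ W p+q v i j
      agree u i j j≢c with j ≟ suc c
      ... | yes ≡.refl = reflexive (≡.trans (W-suc u v i) (≡.sym (W-suc p+q v i)))
      ... | no j≢1+c   = reflexive (≡.trans (W-other u v i j j≢c j≢1+c) (≡.sym (W-other p+q v i j j≢c j≢1+c)))

  -- Induction on the right-hand column: swapping it with its left neighbour brings it closer to
  -- `p`, and the adjacent case ends the descent.
  det-equal-columns : (q : Fin (suc n)) (M : Matrix (suc n)) (p : Fin (suc n)) → p Fin.< q →
    (∀ i → M i p ≈ M i q) → det M ≈ 0#
  det-equal-columns {n} = <-weakInduction P (λ _ _ ()) step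
    where
    P : Fin (suc n) → Set _
    P q = (M : Matrix (suc n)) (p : Fin (suc n)) → p Fin.< q → (∀ i → M i p ≈ M i q) → det M ≈ 0#
    step : (c : Fin n) → P (inject₁ c) → P (suc c)
    step c ih M p p<1+c eq with p ≟ inject₁ c
    ... | yes ≡.refl = det-adjacent-equal M c eq
    ... | no  p≢c    = begin
      det M       ≈⟨ -‿involutive (det M) ⟨
      - - det M   ≈⟨ -‿cong (det-adjacent-swap M N c N-c N-1+c N-other) ⟨
      - det N     ≈⟨ -‿cong (ih N p p<c λ i → trans (N-other i p p≢c (<⇒≢ p<1+c)) (trans (eq i) (sym (N-c i)))) ⟩
      - 0#        ≈⟨ -0#≈0# ⟩
      0#          ∎
      where
      p<c : p Fin.< inject₁ c
      p<c = ≤∧≢⇒< (<⇒≤pred p<1+c) p≢c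
      N : Matrix (suc n)
      N i = updateAt (updateAt (M i) (inject₁ c) (const (M i (suc c)))) (suc c) (const (M i (inject₁ c)))
      N-c : ∀ i → N i (inject₁ c) ≈ M i (suc c)
      N-c i = reflexive (≡.trans (updateAt-minimal (inject₁ c) (suc c) _ (inject₁≢suc c)) (updateAt-updates (inject₁ c) (M i)))
      N-1+c : ∀ i → N i (suc c) ≈ M i (inject₁ c)
      N-1+c i = reflexive (updateAt-updates (suc c) (updateAt (M i) (inject₁ c) (const (M i (suc c)))))
      N-other : ∀ i j → j ≢ inject₁ c → j ≢ suc c → N i j ≈ M i j
      N-other i j j≢c j≢1+c = reflexive (≡.trans (updateAt-minimal j (suc c) _ j≢1+c) (updateAt-minimal j (inject₁ c) (M i) j≢c))

  -- Deleting the top row and any column but the last preserves the shape of the last column, and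
  -- the last term of the expansion has coefficient zero. The corner lies on the diagonal, so no
  -- sign appears.
  det-last-column : (M : Matrix (suc n)) → (∀ i → M (inject₁ i) (Fin.fromℕ n) ≈ 0#) →
    det M ≈ M (Fin.fromℕ n) (Fin.fromℕ n) * det {n} (λ i j → M (inject₁ i) (inject₁ j))
  det-last-column {zero}  M _ = trans (+-identityʳ _) (*-identityˡ _)
  det-last-column {suc n} M zeros = begin
    sum (laplace M)                                      ≈⟨ sum-init-last (laplace M) ⟩
    sum (laplace M ∘ inject₁) + laplace M (Fin.fromℕ (suc n))   ≈⟨ +-cong (sum-cong-≋ step) last-term ⟩
    sum (λ j → M last last * laplace M′ j) + 0#          ≈⟨ +-identityʳ _ ⟩
    sum (λ j → M last last * laplace M′ j)               ≈⟨ *-distribˡ-sum _ (laplace M′) ⟨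
    M last last * det M′ ∎
    where
    last = Fin.fromℕ (suc n)
    M′ : Matrix (suc n)
    M′ i j = M (inject₁ i) (inject₁ j)
    last-term : laplace M last ≈ 0#
    last-term = trans (*-congˡ (trans (*-congʳ (zeros zero)) (zeroˡ _))) (zeroʳ _)
    minor-det : ∀ j → det (minor M (inject₁ j)) ≈ M last last * det (minor M′ j)
    minor-det j = trans
      (det-last-column (minor M (inject₁ j)) λ i → trans (reflexive (≡.cong (M (suc (inject₁ i))) (punchIn-fromℕ j))) (zeros (suc i)))
      (*-cong (reflexive (≡.cong (M last) (punchIn-fromℕ j)))
              (det-cong λ i k → reflexive (≡.cong (M (suc (inject₁ i))) (punchIn-inject₁ j k))))
    step : ∀ j → laplace M (inject₁ j) ≈ M last last * laplace M′ j
    step j = trans (*-cong (sign-inject₁ j) (trans (*-congˡ (minor-det j)) (x∙yz≈y∙xz _ _ _))) (x∙yz≈y∙xz _ _ _)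

-- Determinants under ring homomorphisms

module DeterminantHomomorphism {a b ℓ₁ ℓ₂ : Level} (R : CommutativeRing a ℓ₁) (T : CommutativeRing b ℓ₂)
  {f : CommutativeRing.Carrier R → CommutativeRing.Carrier T}
  (f-hom : IsRingHomomorphism (CommutativeRing.rawRing R) (CommutativeRing.rawRing T) f) where
  private
    module R = CommutativeRing R
    module T = CommutativeRing T
    module detR = Determinant R.rawRing
    module detT = Determinant T.rawRing
    module ΣR = RawSemiringDefs (Semiring.rawSemiring R.semiring)
    module ΣT = RawSemiringDefs (Semiring.rawSemiring T.semiring)
  open IsRingHomomorphism f-hom

  sum-homo : ∀ {n} (g : Fin n → R.Carrier) {h : Fin n → T.Carrier} → (∀ i → f (g i) T.≈ h i) → f (ΣR.sum g) T.≈ ΣT.sum h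
  sum-homo {zero}  g eq = 0#-homo
  sum-homo {suc n} g eq = T.trans (+-homo _ _) (T.+-cong (eq zero) (sum-homo (g ∘ suc) (eq ∘ suc)))

  sign-homo : ∀ n → f ((R.- R.1#) ΣR.^ n) T.≈ (T.- T.1#) ΣT.^ n
  sign-homo zero    = 1#-homo
  sign-homo (suc n) = T.trans (*-homo _ _) (T.*-cong (T.trans (-‿homo _) (T.-‿cong 1#-homo)) (sign-homo n))

  det-homo : ∀ {n} (M : detR.Matrix n) → f (detR.det M) T.≈ detT.det (λ i j → f (M i j))
  det-homo {zero}  M = 1#-homo
  det-homo {suc n} M = sum-homo (λ j → (R.- R.1#) ΣR.^ toℕ j R.* (M zero j R.* detR.det (detR.minor M j))) λ j → T.trans (*-homo _ _)
    (T.*-cong (sign-homo (toℕ j)) (T.trans (*-homo _ _) (T.*-congˡ (det-homo (detR.minor M j)))))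

open ≡ using (refl; sym; trans; cong; cong₂; subst; subst₂)
open ≡.≡-Reasoning

infixl 5 _▷_
_▷_ : ∀ {a} {A : Set a} {n} → Vector A n → A → Vector A (suc n)
_▷_ {n = n} xs x = insertAt xs (Fin.fromℕ n) x

▷-inject₁ : ∀ {a} {A : Set a} {n} (xs : Vector A n) x i → (xs ▷ x) (inject₁ i) ≡ xs i
▷-inject₁ xs x zero    = refl
▷-inject₁ xs x (suc i) = ▷-inject₁ (xs ∘ suc) x i

▷-last : ∀ {a} {A : Set a} {n} (xs : Vector A n) x → (xs ▷ x) (Fin.fromℕ n) ≡ x
▷-last {n = n} xs x = insertAt-lookup xs (Fin.fromℕ n) x

-- Dual numbers over the integers and linear functionals

module DualNumbers where
  open import Data.Integer.Base using (-_; _+_; _*_)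

  infix 5 _+ε_
  record Dual : Set where
    constructor _+ε_
    field
      re du : ℤ

  infixl 6 _⊕_
  infixl 7 _⊛_
  infix 8 neg_

  _⊕_ _⊛_ : Dual → Dual → Dual
  (a +ε b) ⊕ (c +ε d) = (a + c) +ε (b + d)
  (a +ε b) ⊛ (c +ε d) = (a * c) +ε (a * d + b * c)

  neg_ : Dual → Dual
  neg (a +ε b) = (- a) +ε (- b)

  ι : ℤ → Dual
  ι a = a +ε 0ℤ

  dualRing : CommutativeRing 0ℓ 0ℓ
  dualRing = record
    { Carrier = Dual ; _≈_ = _≡_ ; _+_ = _⊕_ ; _*_ = _⊛_ ; -_ = neg_ ; 0# = ι 0ℤ ; 1# = ι 1ℤ
    ; isCommutativeRing = record
      { isRing = record
        { +-isAbelianGroup = record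
          { isGroup = record
            { isMonoid = record
              { isSemigroup = record
                { isMagma = record { isEquivalence = ≡.isEquivalence ; ∙-cong = cong₂ _⊕_ }
                ; assoc = λ (a +ε b) (c +ε d) (e +ε f) → cong₂ _+ε_ (ℤ.+-assoc a c e) (ℤ.+-assoc b d f)
                }
              ; identity = (λ (a +ε b) → cong₂ _+ε_ (ℤ.+-identityˡ a) (ℤ.+-identityˡ b))
                         , (λ (a +ε b) → cong₂ _+ε_ (ℤ.+-identityʳ a) (ℤ.+-identityʳ b))
              }
            ; inverse = (λ (a +ε b) → cong₂ _+ε_ (ℤ.+-inverseˡ a) (ℤ.+-inverseˡ b))
                      , (λ (a +ε b) → cong₂ _+ε_ (ℤ.+-inverseʳ a) (ℤ.+-inverseʳ b))
            ; ⁻¹-cong = cong neg_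
            }
          ; comm = λ (a +ε b) (c +ε d) → cong₂ _+ε_ (ℤ.+-comm a c) (ℤ.+-comm b d)
          }
        ; *-cong = cong₂ _⊛_
        ; *-assoc = λ (a +ε b) (c +ε d) (e +ε f) → cong₂ _+ε_ (ℤ.*-assoc a c e) (assocᵈ a b c d e f)
        ; *-identity = (λ (a +ε b) → cong₂ _+ε_ (ℤ.*-identityˡ a) (identityˡᵈ a b))
                     , (λ (a +ε b) → cong₂ _+ε_ (ℤ.*-identityʳ a) (identityʳᵈ a b))
        ; distrib = (λ (a +ε b) (c +ε d) (e +ε f) → cong₂ _+ε_ (ℤ.*-distribˡ-+ a c e) (distribˡᵈ a b c d e f))
                  , (λ (a +ε b) (c +ε d) (e +ε f) → cong₂ _+ε_ (ℤ.*-distribʳ-+ a c e) (distribʳᵈ a b c d e f))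
        }
      ; *-comm = λ (a +ε b) (c +ε d) → cong₂ _+ε_ (ℤ.*-comm a c) (commᵈ a b c d)
      }
    }
    where
    assocᵈ : ∀ a b c d e f → a * c * f + (a * d + b * c) * e ≡ a * (c * f + d * e) + b * (c * e)
    assocᵈ = solve-∀
    identityˡᵈ : ∀ a b → 1ℤ * b + 0ℤ * a ≡ b
    identityˡᵈ = solve-∀
    identityʳᵈ : ∀ a b → a * 0ℤ + b * 1ℤ ≡ b
    identityʳᵈ = solve-∀
    distribˡᵈ : ∀ a b c d e f → a * (d + f) + b * (c + e) ≡ a * d + b * c + (a * f + b * e)
    distribˡᵈ = solve-∀
    distribʳᵈ : ∀ a b c d e f → (c + e) * b + (d + f) * a ≡ c * b + d * a + (e * b + f * a)
    distribʳᵈ = solve-∀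
    commᵈ : ∀ a b c d → a * d + b * c ≡ c * b + d * a
    commᵈ = solve-∀

  dualAlmostRing : AlmostCommutativeRing 0ℓ 0ℓ
  dualAlmostRing = fromCommutativeRing dualRing λ where
    ((+ 0) +ε (+ 0)) → just refl
    _            → nothing

  𝟙 : Dual
  𝟙 = ι 1ℤ

  infixr 9 _^ᴰ_
  _^ᴰ_ : Dual → ℕ → Dual
  x ^ᴰ zero  = 𝟙
  x ^ᴰ suc n = x ⊛ x ^ᴰ n

  DualFunction : Set
  DualFunction = Dual → Dual

  -- Pointwise equal functions need not be propositionally equal, so invariance under pointwise
  -- equality is part of the notion. Besides `L`, determinants viewed as functions of one column
  -- will be instances.
  record IsLinear (ψ : DualFunction → ℤ) : Set where
    field
      respects : ∀ {f g} → f ≗ g → ψ f ≡ ψ g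
      linear   : ∀ a b f g → ψ (λ x → ι a ⊛ f x ⊕ ι b ⊛ g x) ≡ a * ψ f + b * ψ g

    linear₃ : ∀ a b c f g h → ψ (λ x → ι a ⊛ f x ⊕ (ι b ⊛ g x ⊕ ι c ⊛ h x)) ≡ a * ψ f + (b * ψ g + c * ψ h)
    linear₃ a b c f g h = begin
      ψ (λ x → ι a ⊛ f x ⊕ (ι b ⊛ g x ⊕ ι c ⊛ h x))        ≡⟨ respects (λ x → 1* (ι a ⊛ f x) (ι b ⊛ g x ⊕ ι c ⊛ h x)) ⟩
      ψ (λ x → ι a ⊛ f x ⊕ ι 1ℤ ⊛ (ι b ⊛ g x ⊕ ι c ⊛ h x)) ≡⟨ linear a 1ℤ f (λ x → ι b ⊛ g x ⊕ ι c ⊛ h x) ⟩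
      a * ψ f + 1ℤ * ψ (λ x → ι b ⊛ g x ⊕ ι c ⊛ h x)        ≡⟨ cong (λ z → a * ψ f + z) (trans (ℤ.*-identityˡ _) (linear b c g h)) ⟩
      a * ψ f + (b * ψ g + c * ψ h) ∎
      where
      1* : ∀ y z → y ⊕ z ≡ y ⊕ 𝟙 ⊛ z
      1* = RingSolver.solve-∀ dualAlmostRing

  open IsLinear

open DualNumbers
open IsLinear

-- Integer sums and factorial products

module IntegerLemmas where
  open import Data.Integer.Base using (-_; _+_; _*_; _-_)
  open SemiringSum (CommutativeRing.semiring ℤ.+-*-commutativeRing) using (sum)

  x≡-x⇒x≡0 : ∀ x → x ≡ - x → x ≡ 0ℤ
  x≡-x⇒x≡0 x x≡-x = ℤ.*-cancelˡ-≡ (+ 2) x 0ℤ (begin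
    + 2 * x ≡⟨ double x ⟩
    x + x   ≡⟨ cong (λ z → x + z) x≡-x ⟩
    x + - x ≡⟨ ℤ.+-inverseʳ x ⟩
    0ℤ      ∎)
    where
    double : ∀ x → + 2 * x ≡ x + x
    double = solve-∀

  sum-telescope : ∀ n (g : ℕ → ℤ) → sum {n} (λ i → g (suc (toℕ i)) - g (toℕ i)) ≡ g n - g 0
  sum-telescope zero    g = sym (ℤ.+-inverseʳ (g 0))
  sum-telescope (suc n) g = begin
    g 1 - g 0 + sum {n} (λ i → g (suc (suc (toℕ i))) - g (suc (toℕ i))) ≡⟨ cong (λ z → g 1 - g 0 + z) (sum-telescope n (g ∘ suc)) ⟩
    g 1 - g 0 + (g (suc n) - g 1)                                       ≡⟨ collapse (g 0) (g 1) (g (suc n)) ⟩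
    g (suc n) - g 0 ∎
    where
    collapse : ∀ a b c → b - a + (c - b) ≡ c - a
    collapse = solve-∀

  sum-neg : ∀ {n} (f : Fin n → ℤ) → sum (λ i → - f i) ≡ - sum f
  sum-neg {zero}  f = refl
  sum-neg {suc n} f = trans (cong (λ z → - f zero + z) (sum-neg (f ∘ suc))) (sym (ℤ.neg-distrib-+ (f zero) _))

  rise : ℤ → ℕ → ℤ
  rise a zero    = 1ℤ
  rise a (suc n) = rise a n * (a + + n)

  rise-shift : ∀ a n → rise a (suc n) ≡ a * rise (1ℤ + a) n
  rise-shift a zero    = base a
    where
    base : ∀ a → 1ℤ * (a + 0ℤ) ≡ a * 1ℤ
    base = solve-∀
  rise-shift a (suc n) = begin
    rise a (suc n) * (a + (1ℤ + + n))      ≡⟨ cong (_* (a + (1ℤ + + n))) (rise-shift a n) ⟩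
    a * rise (1ℤ + a) n * (a + (1ℤ + + n)) ≡⟨ rearrange a (rise (1ℤ + a) n) (+ n) ⟩
    a * (rise (1ℤ + a) n * (1ℤ + a + + n)) ∎
    where
    rearrange : ∀ a r n → a * r * (a + (1ℤ + n)) ≡ a * (r * (1ℤ + a + n))
    rearrange = solve-∀

  -- W t k = (1 + t)_k k! and F n y = n! y (y - 1) ⋯ (y - n + 1).
  W : ℤ → ℕ → ℤ
  W t zero    = 1ℤ
  W t (suc k) = W t k * ((1ℤ + t + + k) * (1ℤ + + k))

  F : ℕ → ℤ → ℤ
  F zero    y = 1ℤ
  F (suc n) y = F n y * ((1ℤ + + n) * (y - + n))

  F-suc : ∀ n y → F (suc n) (1ℤ + y) ≡ F n y * ((1ℤ + + n) * (1ℤ + y))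
  F-suc zero    y = base y
    where
    base : ∀ y → 1ℤ * ((1ℤ + 0ℤ) * (1ℤ + y - 0ℤ)) ≡ 1ℤ * ((1ℤ + 0ℤ) * (1ℤ + y))
    base = solve-∀
  F-suc (suc n) y = begin
    F (suc n) (1ℤ + y) * ((1ℤ + (1ℤ + + n)) * (1ℤ + y - (1ℤ + + n)))
      ≡⟨ cong (_* ((1ℤ + (1ℤ + + n)) * (1ℤ + y - (1ℤ + + n)))) (F-suc n y) ⟩
    F n y * ((1ℤ + + n) * (1ℤ + y)) * ((1ℤ + (1ℤ + + n)) * (1ℤ + y - (1ℤ + + n)))
      ≡⟨ rearrange (F n y) (+ n) y ⟩
    F n y * ((1ℤ + + n) * (y - + n)) * ((1ℤ + (1ℤ + + n)) * (1ℤ + y)) ∎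
    where
    rearrange : ∀ f n y → f * ((1ℤ + n) * (1ℤ + y)) * ((1ℤ + (1ℤ + n)) * (1ℤ + y - (1ℤ + n))) ≡
                          f * ((1ℤ + n) * (y - n)) * ((1ℤ + (1ℤ + n)) * (1ℤ + y))
    rearrange = solve-∀

  F-zero : ∀ {n j} → j < n → F n (+ j) ≡ 0ℤ
  F-zero {suc n} {zero}  _     = F-at-0 n
    where
    F-at-0 : ∀ n → F (suc n) 0ℤ ≡ 0ℤ
    F-at-0 zero    = refl
    F-at-0 (suc n) = cong (_* ((1ℤ + (1ℤ + + n)) * (0ℤ - (1ℤ + + n)))) (F-at-0 n)
  F-zero {suc n} {suc j} 1+j<1+n = trans (F-suc n (+ j))
    (cong (_* ((1ℤ + + n) * (1ℤ + + j))) (F-zero (s<s⁻¹ 1+j<1+n)))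

open IntegerLemmas

-- The derivative functional and its symmetry

module Moments (s : ℕ) where
  open import Data.Integer.Base using (-_; _+_; _*_; _-_; _^_; _⊖_)
  open SemiringSum (CommutativeRing.semiring ℤ.+-*-commutativeRing)
    using (sum; sum-cong-≗; sum-permute; ∑-distrib-+; *-distribˡ-sum)

  σ : Dual
  σ = ι (+ suc s)

  node : ℕ → Dual
  node r = (+ r) +ε 1ℤ

  L : DualFunction → ℤ
  L f = sum {s} λ i → Dual.du (f (node (suc (toℕ i))))

  L-isLinear : IsLinear L
  L-isLinear .respects f≗g = sum-cong-≗ {s} λ i → cong Dual.du (f≗g (node (suc (toℕ i))))
  L-isLinear .linear a b f g = begin
    sum {s} (λ i → a * du-f i + 0ℤ * Dual.re (f (x i)) + (b * du-g i + 0ℤ * Dual.re (g (x i))))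
      ≡⟨ sum-cong-≗ {s} (λ i → drop (a * du-f i) (Dual.re (f (x i))) (b * du-g i) (Dual.re (g (x i)))) ⟩
    sum {s} (λ i → a * du-f i + b * du-g i)
      ≡⟨ ∑-distrib-+ {s} (λ i → a * du-f i) (λ i → b * du-g i) ⟩
    sum {s} (λ i → a * du-f i) + sum {s} (λ i → b * du-g i)
      ≡⟨ cong₂ _+_ (*-distribˡ-sum {s} a du-f) (*-distribˡ-sum {s} b du-g) ⟨
    a * L f + b * L g ∎
    where
    x : Fin s → Dual
    x i = node (suc (toℕ i))
    du-f du-g : Fin s → ℤ
    du-f i = Dual.du (f (x i))
    du-g i = Dual.du (g (x i))
    drop : ∀ p r q t → p + 0ℤ * r + (q + 0ℤ * t) ≡ p + q
    drop = solve-∀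

  L-weighted-isLinear : (w : DualFunction) → IsLinear (λ f → L (λ x → f x ⊛ w x))
  L-weighted-isLinear w .respects {f} {g} f≗g = respects L-isLinear {λ x → f x ⊛ w x} {λ x → g x ⊛ w x} λ x → cong (_⊛ w x) (f≗g x)
  L-weighted-isLinear w .linear a b f g = trans
    (respects L-isLinear {λ x → (ι a ⊛ f x ⊕ ι b ⊛ g x) ⊛ w x} {λ x → ι a ⊛ (f x ⊛ w x) ⊕ ι b ⊛ (g x ⊛ w x)}
      λ x → distribute (ι a) (f x) (ι b) (g x) (w x))
    (linear L-isLinear a b (λ x → f x ⊛ w x) (λ x → g x ⊛ w x))
    where
    distribute : ∀ a f b g w → (a ⊛ f ⊕ b ⊛ g) ⊛ w ≡ a ⊛ (f ⊛ w) ⊕ b ⊛ (g ⊛ w)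
    distribute = RingSolver.solve-∀ dualAlmostRing

  L-telescope : ∀ G → L (λ x → G x ⊕ neg (G (x ⊕ neg 𝟙))) ≡ Dual.du (G (node s)) - Dual.du (G (node 0))
  L-telescope G = sum-telescope s (Dual.du ∘ G ∘ node)

  conj : Dual → Dual
  conj (a +ε b) = a +ε - b

  conj-⊛ : ∀ x y → conj (x ⊛ y) ≡ conj x ⊛ conj y
  conj-⊛ (a +ε b) (c +ε d) = cong (λ z → a * c +ε z) (eq a b c d)
    where
    eq : ∀ a b c d → - (a * d + b * c) ≡ a * - d + - b * c
    eq = solve-∀

  conj-⊕ : ∀ x y → conj (x ⊕ y) ≡ conj x ⊕ conj y
  conj-⊕ (a +ε b) (c +ε d) = cong (λ z → a + c +ε z) (ℤ.neg-distrib-+ b d)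

  -- The conjugation undoes the sign change of ε, so that r + ε is sent to (s + 1 - r) + ε.
  reflect : Dual → Dual
  reflect x = σ ⊕ neg (conj x)

  Even : DualFunction → Set
  Even f = ∀ x → f (reflect x) ≡ conj (f x)

  Even-⊛ : ∀ {f g} → Even f → Even g → Even (λ x → f x ⊛ g x)
  Even-⊛ {f} {g} f-even g-even x = trans (cong₂ _⊛_ (f-even x) (g-even x)) (sym (conj-⊛ (f x) (g x)))

  Even-⊕ : ∀ {f g} → Even f → Even g → Even (λ x → f x ⊕ g x)
  Even-⊕ {f} {g} f-even g-even x = trans (cong₂ _⊕_ (f-even x) (g-even x)) (sym (conj-⊕ (f x) (g x)))

  -- The derivative of a symmetric function is antisymmetric, so reversing the order of the nodes
  -- negates the sum.
  L-even : ∀ {f} → Even f → L f ≡ 0ℤ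
  L-even {f} f-even = x≡-x⇒x≡0 (L f) (begin
    L f                               ≡⟨ sum-permute {s} {s} value Permutation.reverse ⟩
    sum {s} (λ i → value (opposite i)) ≡⟨ sum-cong-≗ {s} flip-sign ⟩
    sum {s} (λ i → - value i)         ≡⟨ sum-neg {s} value ⟩
    - L f ∎)
    where
    value : Fin s → ℤ
    value i = Dual.du (f (node (suc (toℕ i))))
    reflected : (i : Fin s) → node (suc (toℕ (opposite i))) ≡ reflect (node (suc (toℕ i)))
    reflected i = cong (λ z → z +ε 1ℤ) (begin
      + suc (toℕ (opposite i))     ≡⟨ cong (+_ ∘ suc) (opposite-prop i) ⟩
      + suc (s ℕ.∸ suc (toℕ i))    ≡⟨ cong +_ (ℕ.+-∸-assoc 1 (toℕ<n i)) ⟨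
      + (suc s ℕ.∸ suc (toℕ i))    ≡⟨ ℤ.⊖-≥ (ℕ.m≤n⇒m≤1+n (toℕ<n i)) ⟨
      suc s ⊖ suc (toℕ i)          ∎)
    flip-sign : ∀ i → value (opposite i) ≡ - value i
    flip-sign i = cong Dual.du (trans (cong f (reflected i)) (f-even (node (suc (toℕ i)))))

  -- w p k x = (x + p)_k (s + 1 - x + p)_k, so that u_k and v_k are the cases p = 0 and p = - s.
  w : ℤ → ℕ → DualFunction
  w p zero    x = 𝟙
  w p (suc k) x = w p k x ⊛ ((x ⊕ (ι p ⊕ ι (+ k))) ⊛ (σ ⊕ neg x ⊕ (ι p ⊕ ι (+ k))))

  w-even : ∀ p k → Even (w p k)
  w-even p zero    x = refl
  w-even p (suc k) x = trans
    (cong₂ _⊛_ (w-even p k x) (trans (swap σ (conj x) (ι p ⊕ ι (+ k))) (sym (conj-quadratic x))))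
    (sym (conj-⊛ (w p k x) _))
    where
    t = ι p ⊕ ι (+ k)
    swap : ∀ s y t → (s ⊕ neg y ⊕ t) ⊛ (s ⊕ neg (s ⊕ neg y) ⊕ t) ≡ (y ⊕ t) ⊛ (s ⊕ neg y ⊕ t)
    swap = RingSolver.solve-∀ dualAlmostRing
    conj-quadratic : ∀ x → conj ((x ⊕ t) ⊛ (σ ⊕ neg x ⊕ t)) ≡ (conj x ⊕ t) ⊛ (σ ⊕ neg (conj x) ⊕ t)
    conj-quadratic x = trans (conj-⊛ (x ⊕ t) (σ ⊕ neg x ⊕ t))
      (cong₂ _⊛_ (conj-⊕ x t) (trans (conj-⊕ (σ ⊕ neg x) t) (cong (_⊕ t) (conj-⊕ σ (neg x)))))

  -- Moving x by one changes only the ends of the two rising products. The relation is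
  -- cross-multiplied by those end factors because there is no division.
  w-shift : ∀ p k x → (x ⊕ neg 𝟙 ⊕ (ι p ⊕ ι (+ k))) ⊛ (σ ⊕ neg x ⊕ ι p) ⊛ w p k (x ⊕ neg 𝟙) ≡
                      (x ⊕ neg 𝟙 ⊕ ι p) ⊛ (σ ⊕ neg x ⊕ (ι p ⊕ ι (+ k))) ⊛ w p k x
  w-shift p zero    x = base (ι p) (x ⊕ neg 𝟙) (σ ⊕ neg x)
    where
    base : ∀ p x y → (x ⊕ (p ⊕ ι 0ℤ)) ⊛ (y ⊕ p) ⊛ 𝟙 ≡ (x ⊕ p) ⊛ (y ⊕ (p ⊕ ι 0ℤ)) ⊛ 𝟙
    base = RingSolver.solve-∀ dualAlmostRing
  w-shift p (suc k) x = begin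
    (x ⊕ neg 𝟙 ⊕ (ι p ⊕ (𝟙 ⊕ ι (+ k)))) ⊛ (σ ⊕ neg x ⊕ ι p) ⊛
      (w p k (x ⊕ neg 𝟙) ⊛ ((x ⊕ neg 𝟙 ⊕ (ι p ⊕ ι (+ k))) ⊛ (σ ⊕ neg (x ⊕ neg 𝟙) ⊕ (ι p ⊕ ι (+ k)))))
      ≡⟨ step₁ x (ι p) (ι (+ k)) σ (w p k (x ⊕ neg 𝟙)) ⟩
    (x ⊕ neg 𝟙 ⊕ (ι p ⊕ ι (+ k))) ⊛ (σ ⊕ neg x ⊕ ι p) ⊛ w p k (x ⊕ neg 𝟙) ⊛
      ((x ⊕ (ι p ⊕ ι (+ k))) ⊛ (σ ⊕ neg x ⊕ (ι p ⊕ (𝟙 ⊕ ι (+ k)))))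
      ≡⟨ cong (_⊛ ((x ⊕ (ι p ⊕ ι (+ k))) ⊛ (σ ⊕ neg x ⊕ (ι p ⊕ (𝟙 ⊕ ι (+ k)))))) (w-shift p k x) ⟩
    (x ⊕ neg 𝟙 ⊕ ι p) ⊛ (σ ⊕ neg x ⊕ (ι p ⊕ ι (+ k))) ⊛ w p k x ⊛
      ((x ⊕ (ι p ⊕ ι (+ k))) ⊛ (σ ⊕ neg x ⊕ (ι p ⊕ (𝟙 ⊕ ι (+ k)))))
      ≡⟨ step₂ x (ι p) (ι (+ k)) σ (w p k x) ⟩
    (x ⊕ neg 𝟙 ⊕ ι p) ⊛ (σ ⊕ neg x ⊕ (ι p ⊕ (𝟙 ⊕ ι (+ k)))) ⊛
      (w p k x ⊛ ((x ⊕ (ι p ⊕ ι (+ k))) ⊛ (σ ⊕ neg x ⊕ (ι p ⊕ ι (+ k))))) ∎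
    where
    step₁ : ∀ x p k s w → (x ⊕ neg 𝟙 ⊕ (p ⊕ (𝟙 ⊕ k))) ⊛ (s ⊕ neg x ⊕ p) ⊛
        (w ⊛ ((x ⊕ neg 𝟙 ⊕ (p ⊕ k)) ⊛ (s ⊕ neg (x ⊕ neg 𝟙) ⊕ (p ⊕ k)))) ≡
      (x ⊕ neg 𝟙 ⊕ (p ⊕ k)) ⊛ (s ⊕ neg x ⊕ p) ⊛ w ⊛ ((x ⊕ (p ⊕ k)) ⊛ (s ⊕ neg x ⊕ (p ⊕ (𝟙 ⊕ k))))
    step₁ = RingSolver.solve-∀ dualAlmostRing
    step₂ : ∀ x p k s w → (x ⊕ neg 𝟙 ⊕ p) ⊛ (s ⊕ neg x ⊕ (p ⊕ k)) ⊛ w ⊛ ((x ⊕ (p ⊕ k)) ⊛ (s ⊕ neg x ⊕ (p ⊕ (𝟙 ⊕ k)))) ≡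
      (x ⊕ neg 𝟙 ⊕ p) ⊛ (s ⊕ neg x ⊕ (p ⊕ (𝟙 ⊕ k))) ⊛ (w ⊛ ((x ⊕ (p ⊕ k)) ⊛ (s ⊕ neg x ⊕ (p ⊕ k))))
    step₂ = RingSolver.solve-∀ dualAlmostRing

  ι-* : ∀ a b → ι (a * b) ≡ ι a ⊛ ι b
  ι-* a b = cong (λ z → a * b +ε z) (sym (zeros a b))
    where
    zeros : ∀ a b → a * 0ℤ + 0ℤ * b ≡ 0ℤ
    zeros = solve-∀

  infinitesimal-⊛ : ∀ a b → Dual.re a ≡ 0ℤ → Dual.re b ≡ 0ℤ → a ⊛ b ≡ ι 0ℤ
  infinitesimal-⊛ (_ +ε b) (_ +ε d) refl refl = cong (λ z → 0ℤ +ε z) (zeros b d)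
    where
    zeros : ∀ b d → 0ℤ * d + b * 0ℤ ≡ 0ℤ
    zeros = solve-∀

  -- The prefactor completes (x + p)_k to (x + p)_{k+1}, which contains x + p even when k = 0.
  w-root : ∀ p k x → Dual.re (x ⊕ ι p) ≡ 0ℤ → Dual.re ((x ⊕ (ι p ⊕ ι (+ k))) ⊛ w p k x) ≡ 0ℤ
  w-root p zero    (a +ε b) eq = trans (base a p) eq
    where
    base : ∀ a p → (a + (p + 0ℤ)) * 1ℤ ≡ a + p
    base = solve-∀
  w-root p (suc k) x eq = begin
    Dual.re (y₁ ⊛ (w p k x ⊛ (y₀ ⊛ z)))  ≡⟨ cong Dual.re (rearrange y₁ (w p k x) y₀ z) ⟩
    Dual.re (y₀ ⊛ w p k x) * Dual.re (y₁ ⊛ z) ≡⟨ cong (_* Dual.re (y₁ ⊛ z)) (w-root p k x eq) ⟩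
    0ℤ * Dual.re (y₁ ⊛ z)                   ≡⟨ ℤ.*-zeroˡ (Dual.re (y₁ ⊛ z)) ⟩
    0ℤ ∎
    where
    y₀ = x ⊕ (ι p ⊕ ι (+ k))
    y₁ = x ⊕ (ι p ⊕ ι (+ suc k))
    z = σ ⊕ neg x ⊕ (ι p ⊕ ι (+ k))
    rearrange : ∀ y₁ w y₀ z → y₁ ⊛ (w ⊛ (y₀ ⊛ z)) ≡ (y₀ ⊛ w) ⊛ (y₁ ⊛ z)
    rearrange = RingSolver.solve-∀ dualAlmostRing

  -- Telescoping and the mixed moments of `u` and `v`

  u v : ℕ → DualFunction
  u = w 0ℤ
  v = w (- + s)

  Y : DualFunction
  Y x = x ⊕ x ⊕ neg σ

  -- Each factor has a double zero, at x = 0 for p = 0 and at x = s for p = - s, so the boundary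
  -- terms of the telescoping sum have no ε-part.
  antidifference-factor : ℤ → ℕ → DualFunction
  antidifference-factor p k x = (x ⊕ ι p) ⊛ ((x ⊕ (ι p ⊕ ι (+ k))) ⊛ w p k x)

  antidifference : ℕ → ℕ → DualFunction
  antidifference k j x = antidifference-factor 0ℤ k x ⊛ antidifference-factor (- + s) j x

  antidifference-factor-root : ∀ p k x → Dual.re (x ⊕ ι p) ≡ 0ℤ → antidifference-factor p k x ≡ ι 0ℤ
  antidifference-factor-root p k x eq = infinitesimal-⊛ (x ⊕ ι p) _ eq (w-root p k x eq)

  L-difference : ∀ k j → L (λ x → antidifference k j x ⊕ neg (antidifference k j (x ⊕ neg 𝟙))) ≡ 0ℤ
  L-difference k j = begin
    L (λ x → antidifference k j x ⊕ neg (antidifference k j (x ⊕ neg 𝟙)))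
      ≡⟨ L-telescope (antidifference k j) ⟩
    Dual.du (antidifference k j (node s)) - Dual.du (antidifference k j (node 0))
      ≡⟨ cong₂ (λ y z → Dual.du y - Dual.du z) at-s at-0 ⟩
    0ℤ ∎
    where
    at-s : antidifference k j (node s) ≡ ι 0ℤ
    at-s = trans
      (cong (antidifference-factor 0ℤ k (node s) ⊛_) (antidifference-factor-root (- + s) j (node s) (ℤ.+-inverseʳ (+ s))))
      (CommutativeRing.zeroʳ dualRing (antidifference-factor 0ℤ k (node s)))
    at-0 : antidifference k j (node 0) ≡ ι 0ℤ
    at-0 = trans
      (cong (_⊛ antidifference-factor (- + s) j (node 0)) (antidifference-factor-root 0ℤ k (node 0) refl))
      (CommutativeRing.zeroˡ dualRing (antidifference-factor (- + s) j (node 0)))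

  -- The bracket is a quartic minus its mirror image under x ↦ s + 1 - x. It is therefore divisible
  -- by `Y`, which is what the moment recurrences exploit.
  difference : ∀ k j x → antidifference k j x ⊕ neg (antidifference k j (x ⊕ neg 𝟙)) ≡
    u k x ⊛ v j x ⊛ (x ⊛ (x ⊕ neg (ι (+ s))) ⊛ (x ⊕ ι (+ k)) ⊛ (x ⊕ neg (ι (+ s)) ⊕ ι (+ j)) ⊕
      neg ((σ ⊕ neg x) ⊛ (𝟙 ⊕ neg x) ⊛ (σ ⊕ neg x ⊕ ι (+ k)) ⊛ (𝟙 ⊕ neg x ⊕ ι (+ j))))
  difference k j x = begin
    antidifference k j x ⊕ neg (antidifference k j (x ⊕ neg 𝟙))
      -- The identity (x - 1)(x - 1 - s) = (s + 1 - x)(1 - x) turns the outer factors into exactly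
      -- the multipliers that `w-shift` asks for at p = 0 and at p = - s. The two families have to
      -- be multiplied for this exchange.
      ≡⟨ cong (λ z → antidifference k j x ⊕ neg z) (trans
           (regroup x (ι (+ s)) (ι (+ k)) (ι (+ j)) (u k (x ⊕ neg 𝟙)) (v j (x ⊕ neg 𝟙)))
           (cong₂ _⊛_ (w-shift 0ℤ k x) (w-shift (- + s) j x))) ⟩
    antidifference k j x ⊕ neg (((x ⊕ neg 𝟙 ⊕ ι 0ℤ) ⊛ (σ ⊕ neg x ⊕ (ι 0ℤ ⊕ ι (+ k))) ⊛ u k x) ⊛
      ((x ⊕ neg 𝟙 ⊕ ι (- + s)) ⊛ (σ ⊕ neg x ⊕ (ι (- + s) ⊕ ι (+ j))) ⊛ v j x))
      ≡⟨ factorise x (ι (+ s)) (ι (+ k)) (ι (+ j)) (u k x) (v j x) ⟩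
    _ ∎
    where
    regroup : ∀ x s k j u v →
      ((x ⊕ neg 𝟙 ⊕ ι 0ℤ) ⊛ ((x ⊕ neg 𝟙 ⊕ (ι 0ℤ ⊕ k)) ⊛ u)) ⊛ ((x ⊕ neg 𝟙 ⊕ neg s) ⊛ ((x ⊕ neg 𝟙 ⊕ (neg s ⊕ j)) ⊛ v)) ≡
      ((x ⊕ neg 𝟙 ⊕ (ι 0ℤ ⊕ k)) ⊛ (𝟙 ⊕ s ⊕ neg x ⊕ ι 0ℤ) ⊛ u) ⊛ ((x ⊕ neg 𝟙 ⊕ (neg s ⊕ j)) ⊛ (𝟙 ⊕ s ⊕ neg x ⊕ neg s) ⊛ v)
    regroup = RingSolver.solve-∀ dualAlmostRing
    factorise : ∀ x s k j u v →
      ((x ⊕ ι 0ℤ) ⊛ ((x ⊕ (ι 0ℤ ⊕ k)) ⊛ u)) ⊛ ((x ⊕ neg s) ⊛ ((x ⊕ (neg s ⊕ j)) ⊛ v)) ⊕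
      neg (((x ⊕ neg 𝟙 ⊕ ι 0ℤ) ⊛ (𝟙 ⊕ s ⊕ neg x ⊕ (ι 0ℤ ⊕ k)) ⊛ u) ⊛ ((x ⊕ neg 𝟙 ⊕ neg s) ⊛ (𝟙 ⊕ s ⊕ neg x ⊕ (neg s ⊕ j)) ⊛ v)) ≡
      u ⊛ v ⊛ (x ⊛ (x ⊕ neg s) ⊛ (x ⊕ k) ⊛ (x ⊕ neg s ⊕ j) ⊕
        neg ((𝟙 ⊕ s ⊕ neg x) ⊛ (𝟙 ⊕ neg x) ⊛ (𝟙 ⊕ s ⊕ neg x ⊕ k) ⊛ (𝟙 ⊕ neg x ⊕ j)))
    factorise = RingSolver.solve-∀ dualAlmostRing

  moment : ℕ → ℕ → ℤ
  moment k j = L (λ x → Y x ⊛ (u k x ⊛ v j x))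

  -- Common to both directions: the hypothesis exhibits a combination of two integrands as a
  -- difference, and `L` kills differences of `antidifference`.
  moment-recurrence : ∀ k j t k′ j′ →
    (∀ x → ι (t * (1ℤ + + k + + j)) ⊛ (Y x ⊛ (u k x ⊛ v j x)) ⊕ ι (- (1ℤ + (1ℤ + + k + + j))) ⊛ (Y x ⊛ (u k′ x ⊛ v j′ x)) ≡
           antidifference k j x ⊕ neg (antidifference k j (x ⊕ neg 𝟙))) →
    (1ℤ + (1ℤ + + k + + j)) * moment k′ j′ ≡ t * ((1ℤ + + k + + j) * moment k j)
  moment-recurrence k j t k′ j′ eq = begin
    n′ * moment k′ j′                                                ≡⟨ rearrange t n n′ (moment k j) (moment k′ j′) ⟩
    t * (n * moment k j) - (t * n * moment k j + - n′ * moment k′ j′) ≡⟨ cong (λ z → t * (n * moment k j) - z) vanish ⟩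
    t * (n * moment k j) - 0ℤ                                        ≡⟨ ℤ.+-identityʳ _ ⟩
    t * (n * moment k j) ∎
    where
    n = 1ℤ + + k + + j
    n′ = 1ℤ + n
    rearrange : ∀ t n n′ m m′ → n′ * m′ ≡ t * (n * m) - (t * n * m + - n′ * m′)
    rearrange = solve-∀
    vanish : t * n * moment k j + - n′ * moment k′ j′ ≡ 0ℤ
    vanish = trans (sym (linear L-isLinear (t * n) (- n′) (λ x → Y x ⊛ (u k x ⊛ v j x)) (λ x → Y x ⊛ (u k′ x ⊛ v j′ x))))
      (trans (respects L-isLinear {λ x → ι (t * n) ⊛ (Y x ⊛ (u k x ⊛ v j x)) ⊕ ι (- n′) ⊛ (Y x ⊛ (u k′ x ⊛ v j′ x))}
                                  {λ x → antidifference k j x ⊕ neg (antidifference k j (x ⊕ neg 𝟙))} eq)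
             (L-difference k j))

  ι-*₃ : ∀ a b c → ι (a * b * c) ≡ ι a ⊛ ι b ⊛ ι c
  ι-*₃ a b c = trans (ι-* (a * b) c) (cong (_⊛ ι c) (ι-* a b))

  -- Dividing the bracket of `difference` by `Y` leaves a symmetric quadratic, hence a constant plus
  -- a multiple of the next factor (x + k)(s + 1 - x + k) of `u`. Writing the same quadratic with
  -- the next factor of `v` gives `moment-sucʳ`.
  moment-sucˡ : ∀ k j → (1ℤ + (1ℤ + + k + + j)) * moment (suc k) j ≡
    (1ℤ + + s + + k) * (1ℤ + + k) * ((1ℤ + + k + + j) * moment k j)
  moment-sucˡ k j = moment-recurrence k j ((1ℤ + + s + + k) * (1ℤ + + k)) (suc k) j λ x → trans
    (cong (λ z → z ⊛ (Y x ⊛ (u k x ⊛ v j x)) ⊕ ι (- (1ℤ + (1ℤ + + k + + j))) ⊛ (Y x ⊛ (u (suc k) x ⊛ v j x)))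
      (ι-*₃ (1ℤ + + s + + k) (1ℤ + + k) (1ℤ + + k + + j)))
    (trans (identity x (ι (+ s)) (ι (+ k)) (ι (+ j)) (u k x) (v j x)) (sym (difference k j x)))
    where
    identity : ∀ x s k j u v →
      (𝟙 ⊕ s ⊕ k) ⊛ (𝟙 ⊕ k) ⊛ (𝟙 ⊕ k ⊕ j) ⊛ ((x ⊕ x ⊕ neg (𝟙 ⊕ s)) ⊛ (u ⊛ v)) ⊕
      neg (𝟙 ⊕ (𝟙 ⊕ k ⊕ j)) ⊛ ((x ⊕ x ⊕ neg (𝟙 ⊕ s)) ⊛ (u ⊛ ((x ⊕ (ι 0ℤ ⊕ k)) ⊛ (𝟙 ⊕ s ⊕ neg x ⊕ (ι 0ℤ ⊕ k))) ⊛ v)) ≡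
      u ⊛ v ⊛ (x ⊛ (x ⊕ neg s) ⊛ (x ⊕ k) ⊛ (x ⊕ neg s ⊕ j) ⊕
        neg ((𝟙 ⊕ s ⊕ neg x) ⊛ (𝟙 ⊕ neg x) ⊛ (𝟙 ⊕ s ⊕ neg x ⊕ k) ⊛ (𝟙 ⊕ neg x ⊕ j)))
    identity = RingSolver.solve-∀ dualAlmostRing

  moment-sucʳ : ∀ k j → (1ℤ + (1ℤ + + k + + j)) * moment k (suc j) ≡
    (1ℤ + - + s + + j) * (1ℤ + + j) * ((1ℤ + + k + + j) * moment k j)
  moment-sucʳ k j = moment-recurrence k j ((1ℤ + - + s + + j) * (1ℤ + + j)) k (suc j) λ x → trans
    (cong (λ z → z ⊛ (Y x ⊛ (u k x ⊛ v j x)) ⊕ ι (- (1ℤ + (1ℤ + + k + + j))) ⊛ (Y x ⊛ (u k x ⊛ v (suc j) x)))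
      (ι-*₃ (1ℤ + - + s + + j) (1ℤ + + j) (1ℤ + + k + + j)))
    (trans (identity x (ι (+ s)) (ι (+ k)) (ι (+ j)) (u k x) (v j x)) (sym (difference k j x)))
    where
    identity : ∀ x s k j u v →
      (𝟙 ⊕ neg s ⊕ j) ⊛ (𝟙 ⊕ j) ⊛ (𝟙 ⊕ k ⊕ j) ⊛ ((x ⊕ x ⊕ neg (𝟙 ⊕ s)) ⊛ (u ⊛ v)) ⊕
      neg (𝟙 ⊕ (𝟙 ⊕ k ⊕ j)) ⊛ ((x ⊕ x ⊕ neg (𝟙 ⊕ s)) ⊛ (u ⊛ (v ⊛ ((x ⊕ (neg s ⊕ j)) ⊛ (𝟙 ⊕ s ⊕ neg x ⊕ (neg s ⊕ j)))))) ≡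
      u ⊛ v ⊛ (x ⊛ (x ⊕ neg s) ⊛ (x ⊕ k) ⊛ (x ⊕ neg s ⊕ j) ⊕
        neg ((𝟙 ⊕ s ⊕ neg x) ⊛ (𝟙 ⊕ neg x) ⊛ (𝟙 ⊕ s ⊕ neg x ⊕ k) ⊛ (𝟙 ⊕ neg x ⊕ j)))
    identity = RingSolver.solve-∀ dualAlmostRing

  moment-0-0 : moment 0 0 ≡ + s * + 2
  moment-0-0 = trans (sum-cong-≗ {s} λ i → ones (+ suc (toℕ i)) (+ suc s)) (sum-const s (+ 2))
    where
    ones : ∀ r t → (r + r + - t) * 0ℤ + + 2 * 1ℤ ≡ + 2
    ones = solve-∀
    sum-const : ∀ n c → sum {n} (λ _ → c) ≡ + n * c
    sum-const zero    c = sym (ℤ.*-zeroˡ c)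
    sum-const (suc n) c = trans (cong (λ z → c + z) (sum-const n c)) (distrib c (+ n))
      where
      distrib : ∀ c n → c + n * c ≡ (1ℤ + n) * c
      distrib = solve-∀

  moment-value : ∀ k j → (1ℤ + + k + + j) * moment k j ≡ + s * + 2 * (W (+ s) k * W (- + s) j)
  moment-value zero zero = trans (cong ((1ℤ + 0ℤ + 0ℤ) *_) moment-0-0) (base (+ s))
    where
    base : ∀ s → (1ℤ + 0ℤ + 0ℤ) * (s * + 2) ≡ s * + 2 * (1ℤ * 1ℤ)
    base = solve-∀
  moment-value (suc k) zero = begin
    (1ℤ + (1ℤ + + k) + 0ℤ) * moment (suc k) 0  ≡⟨ cong (_* moment (suc k) 0) (reassoc (+ k)) ⟩
    (1ℤ + (1ℤ + + k + 0ℤ)) * moment (suc k) 0  ≡⟨ moment-sucˡ k 0 ⟩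
    (1ℤ + + s + + k) * (1ℤ + + k) * ((1ℤ + + k + 0ℤ) * moment k 0)
      ≡⟨ cong ((1ℤ + + s + + k) * (1ℤ + + k) *_) (moment-value k 0) ⟩
    (1ℤ + + s + + k) * (1ℤ + + k) * (+ s * + 2 * (W (+ s) k * 1ℤ))
      ≡⟨ rearrange (+ s) (+ k) (W (+ s) k) ⟩
    + s * + 2 * (W (+ s) k * ((1ℤ + + s + + k) * (1ℤ + + k)) * 1ℤ) ∎
    where
    reassoc : ∀ k → 1ℤ + (1ℤ + k) + 0ℤ ≡ 1ℤ + (1ℤ + k + 0ℤ)
    reassoc = solve-∀
    rearrange : ∀ s k W → (1ℤ + s + k) * (1ℤ + k) * (s * + 2 * (W * 1ℤ)) ≡ s * + 2 * (W * ((1ℤ + s + k) * (1ℤ + k)) * 1ℤ)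
    rearrange = solve-∀
  moment-value k (suc j) = begin
    (1ℤ + + k + (1ℤ + + j)) * moment k (suc j)  ≡⟨ cong (_* moment k (suc j)) (reassoc (+ k) (+ j)) ⟩
    (1ℤ + (1ℤ + + k + + j)) * moment k (suc j)  ≡⟨ moment-sucʳ k j ⟩
    (1ℤ + - + s + + j) * (1ℤ + + j) * ((1ℤ + + k + + j) * moment k j)
      ≡⟨ cong ((1ℤ + - + s + + j) * (1ℤ + + j) *_) (moment-value k j) ⟩
    (1ℤ + - + s + + j) * (1ℤ + + j) * (+ s * + 2 * (W (+ s) k * W (- + s) j))
      ≡⟨ rearrange (+ s) (+ j) (W (+ s) k) (W (- + s) j) ⟩
    + s * + 2 * (W (+ s) k * (W (- + s) j * ((1ℤ + - + s + + j) * (1ℤ + + j)))) ∎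
    where
    reassoc : ∀ k j → 1ℤ + k + (1ℤ + j) ≡ 1ℤ + (1ℤ + k + j)
    reassoc = solve-∀
    rearrange : ∀ s j W W′ → (1ℤ + - s + j) * (1ℤ + j) * (s * + 2 * (W * W′)) ≡ s * + 2 * (W * (W′ * ((1ℤ + - s + j) * (1ℤ + j))))
    rearrange = solve-∀

  -- The combinations `P` and their moments

  -- Over a common denominator the moments of `P n b` and `P n (suc b)` against v_j are in the ratio
  -- of b + j + n + 2 to (b + j + 1)(1 + s + n + b)(1 + n + b). At j = n the linear forms in j take
  -- the values `β n b` and n + b + 1, so these weights produce a cancellation there.
  α β : ℕ → ℕ → ℤ
  α n b = - ((1ℤ + + n + + b) * ((1ℤ + + s + (+ n + + b)) * (1ℤ + + n + + b)))
  β n b = + 2 + + n + + n + + b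

  -- P n b is a combination of u_b, …, u_{b+n}. The weights make the moment of P (suc n) b against
  -- v_j acquire the factor j - n, so that it vanishes for all j ≤ n.
  P : ℕ → ℕ → DualFunction
  P zero    b x = u b x
  P (suc n) b x = ι (α n b) ⊛ P n b x
                ⊕ ι (β n b) ⊛ P n (suc b) x

  P-even : ∀ n b → Even (P n b)
  P-even zero    b = w-even 0ℤ b
  P-even (suc n) b =
    Even-⊕ {λ x → ι (α n b) ⊛ P n b x} {λ x → ι (β n b) ⊛ P n (suc b) x}
      (Even-⊛ {λ _ → ι (α n b)} {P n b} (λ _ → refl) (P-even n b))
      (Even-⊛ {λ _ → ι (β n b)} {P n (suc b)} (λ _ → refl) (P-even n (suc b)))

  P-moment : ℕ → ℕ → ℕ → ℤ
  P-moment n b j = L (λ x → Y x ⊛ (P n b x ⊛ v j x))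

  P-moment-suc : ∀ n b j → P-moment (suc n) b j ≡
    α n b * P-moment n b j +
    β n b * P-moment n (suc b) j
  P-moment-suc n b j = trans
    (respects L-isLinear {λ x → Y x ⊛ (P (suc n) b x ⊛ v j x)}
      {λ x → ι (α n b) ⊛ (Y x ⊛ (P n b x ⊛ v j x)) ⊕ ι (β n b) ⊛ (Y x ⊛ (P n (suc b) x ⊛ v j x))}
      λ x → distribute (Y x) (ι (α n b)) (P n b x) (ι (β n b)) (P n (suc b) x) (v j x))
    (linear L-isLinear (α n b) (β n b) (λ x → Y x ⊛ (P n b x ⊛ v j x)) (λ x → Y x ⊛ (P n (suc b) x ⊛ v j x)))
    where
    distribute : ∀ y a p b q v → y ⊛ ((a ⊛ p ⊕ b ⊛ q) ⊛ v) ≡ a ⊛ (y ⊛ (p ⊛ v)) ⊕ b ⊛ (y ⊛ (q ⊛ v))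
    distribute = RingSolver.solve-∀ dualAlmostRing

  -- Each step lengthens the denominator by one factor and multiplies the numerator by (1 + n)(j -
  -- n), which builds up `F`.
  P-moment-value : ∀ n b j → rise (1ℤ + + b + + j) (suc n) * P-moment n b j ≡
    + s * + 2 * (W (+ s) (n ℕ.+ b) * W (- + s) j) * F n (+ j)
  P-moment-value zero b j = begin
    1ℤ * (1ℤ + + b + + j + 0ℤ) * moment b j ≡⟨ simplify (1ℤ + + b + + j) (moment b j) ⟩
    (1ℤ + + b + + j) * moment b j           ≡⟨ moment-value b j ⟩
    + s * + 2 * (W (+ s) b * W (- + s) j)   ≡⟨ ℤ.*-identityʳ _ ⟨
    + s * + 2 * (W (+ s) b * W (- + s) j) * 1ℤ ∎
    where
    simplify : ∀ a m → 1ℤ * (a + 0ℤ) * m ≡ a * m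
    simplify = solve-∀
  P-moment-value (suc n) b j = begin
    rise a (suc (suc n)) * P-moment (suc n) b j
      ≡⟨ cong (rise a (suc (suc n)) *_) (P-moment-suc n b j) ⟩
    rise a (suc (suc n)) * (α n b * M₀ + β n b * M₁)
      ≡⟨ ℤ.*-distribˡ-+ (rise a (suc (suc n))) (α n b * M₀) (β n b * M₁) ⟩
    rise a (suc (suc n)) * (α n b * M₀) + rise a (suc (suc n)) * (β n b * M₁)
      -- The denominators for b and b + 1 start one apart, so the common one is split at its last
      -- factor for the former and at its first factor for the latter.
      ≡⟨ cong₂ _+_ (pull-right (rise a (suc n)) (a + (1ℤ + + n)) (α n b) M₀)
           (trans (cong (_* (β n b * M₁)) (rise-shift a (suc n))) (pull-left a (rise (1ℤ + a) (suc n)) (β n b) M₁)) ⟩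
    (a + (1ℤ + + n)) * α n b * (rise a (suc n) * M₀) + a * β n b * (rise (1ℤ + a) (suc n) * M₁)
      ≡⟨ cong₂ (λ y z → (a + (1ℤ + + n)) * α n b * y + a * β n b * z) (P-moment-value n b j) shifted ⟩
    (a + (1ℤ + + n)) * α n b * (+ s * + 2 * (W (+ s) (n ℕ.+ b) * W (- + s) j) * F n (+ j)) +
    a * β n b * (+ s * + 2 * (W (+ s) (suc (n ℕ.+ b)) * W (- + s) j) * F n (+ j))
      ≡⟨ combine (+ s) (+ n) (+ b) (+ j) (W (+ s) (n ℕ.+ b)) (W (- + s) j) (F n (+ j)) ⟩
    + s * + 2 * (W (+ s) (suc (n ℕ.+ b)) * W (- + s) j) * F (suc n) (+ j) ∎
    where
    a = 1ℤ + + b + + j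
    M₀ = P-moment n b j
    M₁ = P-moment n (suc b) j
    pull-right : ∀ r t α M → r * t * (α * M) ≡ t * α * (r * M)
    pull-right = solve-∀
    pull-left : ∀ t r β M → t * r * (β * M) ≡ t * β * (r * M)
    pull-left = solve-∀
    reassoc : ∀ b j → 1ℤ + (1ℤ + b + j) ≡ 1ℤ + (1ℤ + b) + j
    reassoc = solve-∀
    shifted : rise (1ℤ + a) (suc n) * M₁ ≡ + s * + 2 * (W (+ s) (suc (n ℕ.+ b)) * W (- + s) j) * F n (+ j)
    shifted = begin
      rise (1ℤ + a) (suc n) * M₁                 ≡⟨ cong (λ z → rise z (suc n) * M₁) (reassoc (+ b) (+ j)) ⟩
      rise (1ℤ + (1ℤ + + b) + + j) (suc n) * M₁  ≡⟨ P-moment-value n (suc b) j ⟩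
      + s * + 2 * (W (+ s) (n ℕ.+ suc b) * W (- + s) j) * F n (+ j)
        ≡⟨ cong (λ z → + s * + 2 * (W (+ s) z * W (- + s) j) * F n (+ j)) (ℕ.+-suc n b) ⟩
      + s * + 2 * (W (+ s) (suc (n ℕ.+ b)) * W (- + s) j) * F n (+ j) ∎
    combine : ∀ s n b j W W′ F →
      (1ℤ + b + j + (1ℤ + n)) * (- ((1ℤ + n + b) * ((1ℤ + s + (n + b)) * (1ℤ + n + b)))) * (s * + 2 * (W * W′) * F) +
      (1ℤ + b + j) * (+ 2 + n + n + b) * (s * + 2 * (W * ((1ℤ + s + (n + b)) * (1ℤ + (n + b))) * W′) * F) ≡
      s * + 2 * (W * ((1ℤ + s + (n + b)) * (1ℤ + (n + b))) * W′) * (F * ((1ℤ + n) * (j - n)))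
    combine = solve-∀

  -- Passing between powers of x and the products `w`

  γ : ℤ → ℕ → ℤ
  γ p k = (p + + k) * (1ℤ + + s + (p + + k))

  -- With t = p + k, (x + t)(s + 1 - x + t) = - x² + (s + 1) x + t (s + 1 + t). This trades one
  -- index of `w` for two powers of x: read forwards it yields leading coefficients, read backwards
  -- it yields orthogonality.
  w-expand : ∀ {ψ} → IsLinear ψ → ∀ p i k →
    ψ (λ x → x ^ᴰ i ⊛ w p (suc k) x) ≡
    -1ℤ * ψ (λ x → x ^ᴰ suc (suc i) ⊛ w p k x) +
    ((1ℤ + + s) * ψ (λ x → x ^ᴰ suc i ⊛ w p k x) + γ p k * ψ (λ x → x ^ᴰ i ⊛ w p k x))
  w-expand ψ-linear p i k = trans
    (respects ψ-linear λ x → trans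
      (expand x (x ^ᴰ i) (w p k x) σ (ι (p + + k)))
      (cong (λ z → ι -1ℤ ⊛ (x ^ᴰ suc (suc i) ⊛ w p k x) ⊕ (σ ⊛ (x ^ᴰ suc i ⊛ w p k x) ⊕ z ⊛ (x ^ᴰ i ⊛ w p k x)))
        (sym (ι-* (p + + k) (1ℤ + + s + (p + + k))))))
    (linear₃ ψ-linear -1ℤ (1ℤ + + s) (γ p k) (λ x → x ^ᴰ suc (suc i) ⊛ w p k x) (λ x → x ^ᴰ suc i ⊛ w p k x) (λ x → x ^ᴰ i ⊛ w p k x))
    where
    expand : ∀ x y w s t → y ⊛ (w ⊛ ((x ⊕ t) ⊛ (s ⊕ neg x ⊕ t))) ≡
      neg 𝟙 ⊛ ((x ⊛ (x ⊛ y)) ⊛ w) ⊕ (s ⊛ ((x ⊛ y) ⊛ w) ⊕ t ⊛ (s ⊕ t) ⊛ (y ⊛ w))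
    expand = RingSolver.solve-∀ dualAlmostRing

  private
    two-more : ∀ i k → i ℕ.+ 2 ℕ.* suc k ≡ suc (suc (i ℕ.+ 2 ℕ.* k))
    two-more = ℕ-Solver.solve-∀

    combination-zero : ∀ a b {x y} → x ≡ 0ℤ → y ≡ 0ℤ → a * x + b * y ≡ 0ℤ
    combination-zero a b refl refl = zeros a b
      where
      zeros : ∀ a b → a * 0ℤ + b * 0ℤ ≡ 0ℤ
      zeros = solve-∀

    combination-fst : ∀ a b {x y} → y ≡ 0ℤ → a * x + b * y ≡ a * x
    combination-fst a b {x} refl = zeros a b x
      where
      zeros : ∀ a b x → a * x + b * 0ℤ ≡ a * x
      zeros = solve-∀

  -- Leading coefficients are read off by functionals that kill the lower powers of x, which avoids
  -- any formal notion of polynomial or degree.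
  module Leading {ψ : DualFunction → ℤ} (ψ-linear : IsLinear ψ) (N : ℕ) (lower : ∀ i → i < N → ψ (_^ᴰ i) ≡ 0ℤ) where

    w-lower : ∀ p k i → i ℕ.+ 2 ℕ.* k < N → ψ (λ x → x ^ᴰ i ⊛ w p k x) ≡ 0ℤ
    w-lower p zero    i i<N = trans
      (respects ψ-linear λ x → CommutativeRing.*-identityʳ dualRing (x ^ᴰ i))
      (lower i (subst (_< N) (ℕ.+-identityʳ i) i<N))
    w-lower p (suc k) i i+2k+2<N = trans (w-expand ψ-linear p i k)
      (cong₂ (λ y z → -1ℤ * y + z) (w-lower p k (suc (suc i)) bound)
        (combination-zero (1ℤ + + s) (γ p k) (w-lower p k (suc i) (ℕ.<⇒≤ bound)) (w-lower p k i (ℕ.<⇒≤ (ℕ.<⇒≤ bound)))))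
      where
      bound : suc (suc (i ℕ.+ 2 ℕ.* k)) < N
      bound = subst (_< N) (two-more i k) i+2k+2<N

    w-leading : ∀ p k i → i ℕ.+ 2 ℕ.* k ≡ N → ψ (λ x → x ^ᴰ i ⊛ w p k x) ≡ -1ℤ ^ k * ψ (_^ᴰ N)
    w-leading p zero    i i≡N = begin
      ψ (λ x → x ^ᴰ i ⊛ 𝟙) ≡⟨ respects ψ-linear (λ x → CommutativeRing.*-identityʳ dualRing (x ^ᴰ i)) ⟩
      ψ (_^ᴰ i)            ≡⟨ cong (λ n → ψ (_^ᴰ n)) (trans (sym (ℕ.+-identityʳ i)) i≡N) ⟩
      ψ (_^ᴰ N)            ≡⟨ ℤ.*-identityˡ _ ⟨
      1ℤ * ψ (_^ᴰ N) ∎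
    w-leading p (suc k) i i+2k+2≡N = begin
      ψ (λ x → x ^ᴰ i ⊛ w p (suc k) x)
        ≡⟨ w-expand ψ-linear p i k ⟩
      _ ≡⟨ cong (λ z → -1ℤ * ψ (λ x → x ^ᴰ suc (suc i) ⊛ w p k x) + z)
             (combination-zero (1ℤ + + s) (γ p k) (w-lower p k (suc i) (ℕ.≤-reflexive bound)) (w-lower p k i (ℕ.<⇒≤ (ℕ.≤-reflexive bound)))) ⟩
      -1ℤ * ψ (λ x → x ^ᴰ suc (suc i) ⊛ w p k x) + 0ℤ
        ≡⟨ ℤ.+-identityʳ _ ⟩
      -1ℤ * ψ (λ x → x ^ᴰ suc (suc i) ⊛ w p k x)
        ≡⟨ cong (-1ℤ *_) (w-leading p k (suc (suc i)) bound) ⟩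
      -1ℤ * (-1ℤ ^ k * ψ (_^ᴰ N))
        ≡⟨ ℤ.*-assoc -1ℤ (-1ℤ ^ k) (ψ (_^ᴰ N)) ⟨
      -1ℤ ^ suc k * ψ (_^ᴰ N) ∎
      where
      bound : suc (suc (i ℕ.+ 2 ℕ.* k)) ≡ N
      bound = trans (sym (two-more i k)) i+2k+2≡N

    P-expand : ∀ n b i → ψ (λ x → x ^ᴰ i ⊛ P (suc n) b x) ≡
      α n b * ψ (λ x → x ^ᴰ i ⊛ P n b x) +
      β n b * ψ (λ x → x ^ᴰ i ⊛ P n (suc b) x)
    P-expand n b i = trans
      (respects ψ-linear λ x → distribute (x ^ᴰ i) (ι (α n b)) (P n b x) (ι (β n b)) (P n (suc b) x))
      (linear ψ-linear (α n b) (β n b) (λ x → x ^ᴰ i ⊛ P n b x) (λ x → x ^ᴰ i ⊛ P n (suc b) x))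
      where
      distribute : ∀ y a p b q → y ⊛ (a ⊛ p ⊕ b ⊛ q) ≡ a ⊛ (y ⊛ p) ⊕ b ⊛ (y ⊛ q)
      distribute = RingSolver.solve-∀ dualAlmostRing

    P-lower : ∀ n b i → i ℕ.+ 2 ℕ.* (n ℕ.+ b) < N → ψ (λ x → x ^ᴰ i ⊛ P n b x) ≡ 0ℤ
    P-lower zero    b i bound = w-lower 0ℤ b i bound
    P-lower (suc n) b i bound = trans (P-expand n b i) (combination-zero (α n b) (β n b)
      (P-lower n b i (ℕ.<⇒≤ (ℕ.<⇒≤ (subst (_< N) (two-more i (n ℕ.+ b)) bound))))
      (P-lower n (suc b) i (subst (λ k → i ℕ.+ 2 ℕ.* k < N) (sym (ℕ.+-suc n b)) bound)))

    -- Only the `β` term reaches the top degree. The values of `β` along the recursion run down from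
    -- 2n + b to n + b + 1, and their product is the rising factorial.
    P-leading : ∀ n b i → i ℕ.+ 2 ℕ.* (n ℕ.+ b) ≡ N →
      ψ (λ x → x ^ᴰ i ⊛ P n b x) ≡ rise (1ℤ + + n + + b) n * (-1ℤ ^ (n ℕ.+ b) * ψ (_^ᴰ N))
    P-leading zero    b i bound = trans (w-leading 0ℤ b i bound) (sym (ℤ.*-identityˡ _))
    P-leading (suc n) b i bound = begin
      ψ (λ x → x ^ᴰ i ⊛ P (suc n) b x)
        ≡⟨ P-expand n b i ⟩
      _ ≡⟨ cong₂ _+_ (trans (cong (α n b *_) (P-lower n b i (ℕ.<⇒≤ (ℕ.≤-reflexive (trans (sym (two-more i (n ℕ.+ b))) bound))))) (ℤ.*-zeroʳ (α n b))) refl ⟩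
      0ℤ + β n b * ψ (λ x → x ^ᴰ i ⊛ P n (suc b) x)
        ≡⟨ ℤ.+-identityˡ _ ⟩
      β n b * ψ (λ x → x ^ᴰ i ⊛ P n (suc b) x)
        ≡⟨ cong (β n b *_) (P-leading n (suc b) i (trans (cong (λ k → i ℕ.+ 2 ℕ.* k) (ℕ.+-suc n b)) bound)) ⟩
      β n b * (rise (1ℤ + + n + (1ℤ + + b)) n * (-1ℤ ^ (n ℕ.+ suc b) * ψ (_^ᴰ N)))
        ≡⟨ cong₂ (λ y k → β n b * (rise y n * (-1ℤ ^ k * ψ (_^ᴰ N)))) (reassoc (+ n) (+ b)) (ℕ.+-suc n b) ⟩
      β n b * (rise (1ℤ + (1ℤ + + n) + + b) n * (-1ℤ ^ suc (n ℕ.+ b) * ψ (_^ᴰ N)))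
        ≡⟨ regroup (+ n) (+ b) (rise (1ℤ + (1ℤ + + n) + + b) n) (-1ℤ ^ suc (n ℕ.+ b) * ψ (_^ᴰ N)) ⟩
      rise (1ℤ + (1ℤ + + n) + + b) (suc n) * (-1ℤ ^ suc (n ℕ.+ b) * ψ (_^ᴰ N)) ∎
      where
      reassoc : ∀ n b → 1ℤ + n + (1ℤ + b) ≡ 1ℤ + (1ℤ + n) + b
      reassoc = solve-∀
      regroup : ∀ n b r z → (+ 2 + n + n + b) * (r * z) ≡ r * (1ℤ + (1ℤ + n) + b + n) * z
      regroup = solve-∀

  -- Each use of `w-reduce` lowers the power of x without raising the degree i + 2j, until only the
  -- powers 0 and 1 remain; the degree bound then keeps the index of `w` in the range of the
  -- hypotheses.
  module Orthogonal {ψ : DualFunction → ℤ} (ψ-linear : IsLinear ψ) (p : ℤ) (m : ℕ)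
    (even : ∀ j → ψ (λ x → x ^ᴰ 0 ⊛ w p j x) ≡ 0ℤ)
    (odd : ∀ j → j < m → ψ (λ x → x ^ᴰ 1 ⊛ w p j x) ≡ 0ℤ) where

    w-reduce : ∀ i j → ψ (λ x → x ^ᴰ suc (suc i) ⊛ w p j x) ≡
      -1ℤ * ψ (λ x → x ^ᴰ i ⊛ w p (suc j) x) +
      ((1ℤ + + s) * ψ (λ x → x ^ᴰ suc i ⊛ w p j x) + γ p j * ψ (λ x → x ^ᴰ i ⊛ w p j x))
    w-reduce i j = trans (solve-for _ rest) (cong (λ z → -1ℤ * z + rest) (sym (w-expand ψ-linear p i j)))
      where
      rest = (1ℤ + + s) * ψ (λ x → x ^ᴰ suc i ⊛ w p j x) + γ p j * ψ (λ x → x ^ᴰ i ⊛ w p j x)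
      solve-for : ∀ a r → a ≡ -1ℤ * (-1ℤ * a + r) + r
      solve-for = solve-∀

    vanish : ∀ i j → i ℕ.+ 2 ℕ.* j < suc (2 ℕ.* m) → ψ (λ x → x ^ᴰ i ⊛ w p j x) ≡ 0ℤ
    vanish zero          j _     = even j
    vanish (suc zero)    j bound = odd j (ℕ.*-cancelˡ-< 2 j m (s<s⁻¹ bound))
    vanish (suc (suc i)) j bound = trans (w-reduce i j)
      (cong₂ (λ y z → -1ℤ * y + z) (vanish i (suc j) (subst (_< suc (2 ℕ.* m)) (sym (two-more i j)) bound))
        (combination-zero (1ℤ + + s) (γ p j) (vanish (suc i) j (ℕ.<⇒≤ bound)) (vanish i j (ℕ.<⇒≤ (ℕ.<⇒≤ bound)))))

    -- In degree 2m + 1 the two lower terms of `w-reduce` die by `vanish`, so each step contributes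
    -- just a sign.
    top : ∀ a j → a ℕ.+ j ≡ m → ψ (λ x → x ^ᴰ suc (2 ℕ.* a) ⊛ w p j x) ≡ -1ℤ ^ a * ψ (λ x → x ^ᴰ 1 ⊛ w p m x)
    top zero    j refl  = sym (ℤ.*-identityˡ _)
    top (suc a) j 1+a+j≡m = begin
      ψ (λ x → x ^ᴰ suc (2 ℕ.* suc a) ⊛ w p j x)
        ≡⟨ cong (λ i → ψ (λ x → x ^ᴰ suc i ⊛ w p j x)) (two-more 0 a) ⟩
      ψ (λ x → x ^ᴰ suc (suc i) ⊛ w p j x)
        ≡⟨ w-reduce i j ⟩
      -1ℤ * ψ (λ x → x ^ᴰ i ⊛ w p (suc j) x) + _
        ≡⟨ cong (λ z → -1ℤ * ψ (λ x → x ^ᴰ i ⊛ w p (suc j) x) + z)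
             (combination-zero (1ℤ + + s) (γ p j) (vanish (suc i) j (ℕ.≤-reflexive bound)) (vanish i j (ℕ.<⇒≤ (ℕ.≤-reflexive bound)))) ⟩
      -1ℤ * ψ (λ x → x ^ᴰ i ⊛ w p (suc j) x) + 0ℤ
        ≡⟨ ℤ.+-identityʳ _ ⟩
      -1ℤ * ψ (λ x → x ^ᴰ i ⊛ w p (suc j) x)
        ≡⟨ cong (-1ℤ *_) (top a (suc j) (trans (ℕ.+-suc a j) 1+a+j≡m)) ⟩
      -1ℤ * (-1ℤ ^ a * ψ (λ x → x ^ᴰ 1 ⊛ w p m x))
        ≡⟨ ℤ.*-assoc -1ℤ (-1ℤ ^ a) _ ⟨
      -1ℤ ^ suc a * ψ (λ x → x ^ᴰ 1 ⊛ w p m x) ∎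
      where
      i = suc (2 ℕ.* a)
      double : ∀ a j → 2 ℕ.+ (1 ℕ.+ 2 ℕ.* a ℕ.+ 2 ℕ.* j) ≡ 1 ℕ.+ 2 ℕ.* (1 ℕ.+ a ℕ.+ j)
      double = ℕ-Solver.solve-∀
      bound : suc (suc (i ℕ.+ 2 ℕ.* j)) ≡ suc (2 ℕ.* m)
      bound = trans (double a j) (cong (λ k → suc (2 ℕ.* k)) 1+a+j≡m)

  -- Orthogonality and norm of `P m 0`

  rise-nonZero : ∀ a n → ∃ λ c → rise (+ suc a) n ≡ + suc c
  rise-nonZero a zero    = 0 , refl
  rise-nonZero a (suc n) with c , eq ← rise-nonZero a n = _ , cong (_* (+ suc a + + n)) eq

  rise-cancel : ∀ a n {x y} → rise (+ suc a) n * x ≡ rise (+ suc a) n * y → x ≡ y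
  rise-cancel a n {x} {y} eq with rise (+ suc a) n | rise-nonZero a n
  ... | _ | c , refl = ℤ.*-cancelˡ-≡ (+ suc c) x y eq

  module _ (m : ℕ) where
    private
      ψ : DualFunction → ℤ
      ψ f = L (λ x → f x ⊛ P m 0 x)

      ψ-linear : IsLinear ψ
      ψ-linear = L-weighted-isLinear (P m 0)

      even : ∀ j → ψ (λ x → x ^ᴰ 0 ⊛ v j x) ≡ 0ℤ
      even j = L-even {λ x → 𝟙 ⊛ v j x ⊛ P m 0 x} (Even-⊛ {λ x → 𝟙 ⊛ v j x} {P m 0}
        (Even-⊛ {λ _ → 𝟙} {v j} (λ _ → refl) (w-even (- + s) j)) (P-even m 0))

    -- `Y` is 2x minus a constant, and the constant pairs to zero by symmetry; moments against `Y`
    -- thus determine those against x.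
    halve : ∀ j → P-moment m 0 j ≡ + 2 * ψ (λ x → x ^ᴰ 1 ⊛ v j x)
    halve j = begin
      P-moment m 0 j
        ≡⟨ respects L-isLinear {λ x → Y x ⊛ (P m 0 x ⊛ v j x)}
             {λ x → ι (+ 2) ⊛ (x ^ᴰ 1 ⊛ v j x ⊛ P m 0 x) ⊕ ι (- + suc s) ⊛ (x ^ᴰ 0 ⊛ v j x ⊛ P m 0 x)}
             (λ x → split x σ (P m 0 x) (v j x)) ⟩
      L (λ x → ι (+ 2) ⊛ (x ^ᴰ 1 ⊛ v j x ⊛ P m 0 x) ⊕ ι (- + suc s) ⊛ (x ^ᴰ 0 ⊛ v j x ⊛ P m 0 x))
        ≡⟨ linear L-isLinear (+ 2) (- + suc s) (λ x → x ^ᴰ 1 ⊛ v j x ⊛ P m 0 x) (λ x → x ^ᴰ 0 ⊛ v j x ⊛ P m 0 x) ⟩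
      + 2 * ψ (λ x → x ^ᴰ 1 ⊛ v j x) + - + suc s * ψ (λ x → x ^ᴰ 0 ⊛ v j x)
        ≡⟨ combination-fst (+ 2) (- + suc s) (even j) ⟩
      + 2 * ψ (λ x → x ^ᴰ 1 ⊛ v j x) ∎
      where
      split : ∀ x s p v → (x ⊕ x ⊕ neg s) ⊛ (p ⊛ v) ≡ (𝟙 ⊕ 𝟙) ⊛ ((x ⊛ 𝟙) ⊛ v ⊛ p) ⊕ neg s ⊛ (𝟙 ⊛ v ⊛ p)
      split = RingSolver.solve-∀ dualAlmostRing

    h-value : ∀ j → rise (1ℤ + + j) (suc m) * ψ (λ x → x ^ᴰ 1 ⊛ v j x) ≡ + s * (W (+ s) m * W (- + s) j * F m (+ j))
    h-value j = ℤ.*-cancelˡ-≡ (+ 2) _ _ (begin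
      + 2 * (rise (1ℤ + + j) (suc m) * ψ (λ x → x ^ᴰ 1 ⊛ v j x))
        ≡⟨ swap (rise (1ℤ + + j) (suc m)) (ψ (λ x → x ^ᴰ 1 ⊛ v j x)) ⟩
      rise (1ℤ + + j) (suc m) * (+ 2 * ψ (λ x → x ^ᴰ 1 ⊛ v j x))
        ≡⟨ cong (rise (1ℤ + + j) (suc m) *_) (halve j) ⟨
      rise (1ℤ + + j) (suc m) * P-moment m 0 j
        ≡⟨ P-moment-value m 0 j ⟩
      + s * + 2 * (W (+ s) (m ℕ.+ 0) * W (- + s) j) * F m (+ j)
        ≡⟨ cong (λ k → + s * + 2 * (W (+ s) k * W (- + s) j) * F m (+ j)) (ℕ.+-identityʳ m) ⟩
      + s * + 2 * (W (+ s) m * W (- + s) j) * F m (+ j)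
        ≡⟨ regroup (+ s) (W (+ s) m * W (- + s) j) (F m (+ j)) ⟩
      + 2 * (+ s * (W (+ s) m * W (- + s) j * F m (+ j))) ∎)
      where
      swap : ∀ r z → + 2 * (r * z) ≡ r * (+ 2 * z)
      swap = solve-∀
      regroup : ∀ s w f → s * + 2 * w * f ≡ + 2 * (s * (w * f))
      regroup = solve-∀

    odd : ∀ j → j < m → ψ (λ x → x ^ᴰ 1 ⊛ v j x) ≡ 0ℤ
    odd j j<m = rise-cancel j (suc m) (begin
      rise (1ℤ + + j) (suc m) * ψ (λ x → x ^ᴰ 1 ⊛ v j x) ≡⟨ h-value j ⟩
      + s * (W (+ s) m * W (- + s) j * F m (+ j))         ≡⟨ cong (λ z → + s * (W (+ s) m * W (- + s) j * z)) (F-zero j<m) ⟩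
      + s * (W (+ s) m * W (- + s) j * 0ℤ)                ≡⟨ zeros (+ s) (W (+ s) m * W (- + s) j) (rise (1ℤ + + j) (suc m)) ⟩
      rise (1ℤ + + j) (suc m) * 0ℤ ∎)
      where
      zeros : ∀ s w r → s * (w * 0ℤ) ≡ r * 0ℤ
      zeros = solve-∀

    private module O = Orthogonal ψ-linear (- + s) m even odd

    h : ℤ
    h = ψ (_^ᴰ suc (2 ℕ.* m))

    P-orthogonal : ∀ i → i < suc (2 ℕ.* m) → ψ (_^ᴰ i) ≡ 0ℤ
    P-orthogonal i bound = trans
      (respects ψ-linear {_^ᴰ i} {λ x → x ^ᴰ i ⊛ 𝟙} λ x → sym (CommutativeRing.*-identityʳ dualRing (x ^ᴰ i)))
      (O.vanish i 0 (subst (_< suc (2 ℕ.* m)) (sym (ℕ.+-identityʳ i)) bound))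

    -- Modulo what P_m annihilates, x^{2m+1} is (-1)^m x v_m, and j = m is the first index at which
    -- `F m` does not vanish.
    P-norm : rise (1ℤ + + m) (suc m) * h ≡ -1ℤ ^ m * (+ s * (W (+ s) m * W (- + s) m * F m (+ m)))
    P-norm = begin
      rise (1ℤ + + m) (suc m) * h
        ≡⟨ cong (rise (1ℤ + + m) (suc m) *_) (trans
             (respects ψ-linear {_^ᴰ suc (2 ℕ.* m)} {λ x → x ^ᴰ suc (2 ℕ.* m) ⊛ 𝟙} λ x → sym (CommutativeRing.*-identityʳ dualRing (x ^ᴰ suc (2 ℕ.* m))))
             (O.top m 0 (ℕ.+-identityʳ m))) ⟩
      rise (1ℤ + + m) (suc m) * (-1ℤ ^ m * ψ (λ x → x ^ᴰ 1 ⊛ v m x))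
        ≡⟨ swap (rise (1ℤ + + m) (suc m)) (-1ℤ ^ m) (ψ (λ x → x ^ᴰ 1 ⊛ v m x)) ⟩
      -1ℤ ^ m * (rise (1ℤ + + m) (suc m) * ψ (λ x → x ^ᴰ 1 ⊛ v m x))
        ≡⟨ cong (-1ℤ ^ m *_) (h-value m) ⟩
      -1ℤ ^ m * (+ s * (W (+ s) m * W (- + s) m * F m (+ m))) ∎
      where
      swap : ∀ r e z → r * (e * z) ≡ e * (r * z)
      swap = solve-∀

  -- Gram determinants as functionals of a column

  open DeterminantProperties ℤ.+-*-commutativeRing

  -- The rows always belong to the powers of x; only the columns vary, so a column operation is an
  -- operation on functions.
  gram : ∀ {n} → Vector DualFunction n → Matrix n
  gram f i j = L (λ x → x ^ᴰ toℕ i ⊛ f j x)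

  powers : ∀ n → Vector DualFunction n
  powers n j x = x ^ᴰ toℕ j

  powers-▷ : ∀ n j → (powers n ▷ (_^ᴰ n)) j ≡ powers (suc n) j
  powers-▷ n j with view j
  ... | ‵fromℕ     = trans (▷-last (powers n) (_^ᴰ n)) (cong (λ k x → x ^ᴰ k) (sym (toℕ-fromℕ n)))
  ... | ‵inject₁ i = trans (▷-inject₁ (powers n) (_^ᴰ n) i) (cong (λ k x → x ^ᴰ k) (sym (toℕ-inject₁ i)))

  gram-cong : ∀ {n} {f g : Vector DualFunction n} → (∀ j → f j ≡ g j) → det (gram f) ≡ det (gram g)
  gram-cong {n} {f} {g} f≡g = det-cong {n} {gram f} {gram g} λ i j → cong (λ p → L (λ x → x ^ᴰ toℕ i ⊛ p x)) (f≡g j)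

  ▷-cong : ∀ {n} {f g : Vector DualFunction n} p → (∀ j → f j ≡ g j) → ∀ j → (f ▷ p) j ≡ (g ▷ p) j
  ▷-cong {f = f} {g} p f≡g j with view j
  ... | ‵fromℕ     = trans (▷-last f p) (sym (▷-last g p))
  ... | ‵inject₁ i = trans (▷-inject₁ f p i) (trans (f≡g i) (sym (▷-inject₁ g p i)))

  -- As a function of its last column the determinant is a linear functional that kills the
  -- functions already present. `Leading` then applies to it and takes the place of explicit column
  -- operations.
  Δ : ∀ {n} → Vector DualFunction n → DualFunction → ℤ
  Δ f p = det (gram (f ▷ p))

  private
    last-column : ∀ {n} (f : Vector DualFunction n) p i → gram (f ▷ p) i (Fin.fromℕ n) ≡ L (λ x → x ^ᴰ toℕ i ⊛ p x)
    last-column f p i = cong (λ q → L (λ x → x ^ᴰ toℕ i ⊛ q x)) (▷-last f p)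

    other-column : ∀ {n} (f : Vector DualFunction n) p i j → gram (f ▷ p) i (inject₁ j) ≡ L (λ x → x ^ᴰ toℕ i ⊛ f j x)
    other-column f p i j = cong (λ q → L (λ x → x ^ᴰ toℕ i ⊛ q x)) (▷-inject₁ f p j)

  Δ-isLinear : ∀ {n} (f : Vector DualFunction n) → IsLinear (Δ f)
  Δ-isLinear {n} f .respects {p} {q} p≗q = det-cong {suc n} {gram (f ▷ p)} {gram (f ▷ q)} entry
    where
    entry : ∀ i j → gram (f ▷ p) i j ≡ gram (f ▷ q) i j
    entry i j with view j
    ... | ‵fromℕ     = trans (last-column f p i) (trans
                         (respects L-isLinear {λ x → x ^ᴰ toℕ i ⊛ p x} {λ x → x ^ᴰ toℕ i ⊛ q x} λ x → cong (x ^ᴰ toℕ i ⊛_) (p≗q x))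
                         (sym (last-column f q i)))
    ... | ‵inject₁ k = trans (other-column f p i k) (sym (other-column f q i k))
  Δ-isLinear {n} f .linear a b p q = det-linear (gram (f ▷ p)) (gram (f ▷ q)) (gram (f ▷ r)) (Fin.fromℕ n) a b at-last others
    where
    r : DualFunction
    r x = ι a ⊛ p x ⊕ ι b ⊛ q x
    at-last : ∀ i → gram (f ▷ r) i (Fin.fromℕ n) ≡ a * gram (f ▷ p) i (Fin.fromℕ n) + b * gram (f ▷ q) i (Fin.fromℕ n)
    at-last i = begin
      gram (f ▷ r) i (Fin.fromℕ n)
        ≡⟨ last-column f r i ⟩
      L (λ x → x ^ᴰ toℕ i ⊛ r x)
        ≡⟨ respects L-isLinear {λ x → x ^ᴰ toℕ i ⊛ r x} {λ x → ι a ⊛ (x ^ᴰ toℕ i ⊛ p x) ⊕ ι b ⊛ (x ^ᴰ toℕ i ⊛ q x)}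
             (λ x → distribute (x ^ᴰ toℕ i) (ι a) (p x) (ι b) (q x)) ⟩
      L (λ x → ι a ⊛ (x ^ᴰ toℕ i ⊛ p x) ⊕ ι b ⊛ (x ^ᴰ toℕ i ⊛ q x))
        ≡⟨ linear L-isLinear a b (λ x → x ^ᴰ toℕ i ⊛ p x) (λ x → x ^ᴰ toℕ i ⊛ q x) ⟩
      a * L (λ x → x ^ᴰ toℕ i ⊛ p x) + b * L (λ x → x ^ᴰ toℕ i ⊛ q x)
        ≡⟨ cong₂ (λ y z → a * y + b * z) (last-column f p i) (last-column f q i) ⟨
      a * gram (f ▷ p) i (Fin.fromℕ n) + b * gram (f ▷ q) i (Fin.fromℕ n) ∎
      where
      distribute : ∀ y a p b q → y ⊛ (a ⊛ p ⊕ b ⊛ q) ≡ a ⊛ (y ⊛ p) ⊕ b ⊛ (y ⊛ q)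
      distribute = RingSolver.solve-∀ dualAlmostRing
    others : ∀ i j → j ≢ Fin.fromℕ n → gram (f ▷ p) i j ≡ gram (f ▷ r) i j × gram (f ▷ q) i j ≡ gram (f ▷ r) i j
    others i j j≢n with view j
    ... | ‵fromℕ     = contradiction refl j≢n
    ... | ‵inject₁ k = trans (other-column f p i k) (sym (other-column f r i k))
                     , trans (other-column f q i k) (sym (other-column f r i k))

  Δ-repeat : ∀ {n} (f : Vector DualFunction n) j → Δ f (f j) ≡ 0ℤ
  Δ-repeat {n} f j = det-equal-columns (Fin.fromℕ n) (gram (f ▷ f j)) (inject₁ j)
    (subst₂ _<_ (sym (toℕ-inject₁ j)) (sym (toℕ-fromℕ n)) (toℕ<n j))
    λ i → trans (other-column f (f j) i j) (sym (last-column f (f j) i))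

  Δ-swap : ∀ {n} (f : Vector DualFunction n) p q → Δ (f ▷ p) q ≡ - Δ (f ▷ q) p
  Δ-swap {n} f p q = det-adjacent-swap (gram (f ▷ q ▷ p)) (gram (f ▷ p ▷ q)) (Fin.fromℕ n)
    (λ i → trans (second-last p q i) (sym (last-column (f ▷ q) p i)))
    (λ i → trans (last-column (f ▷ p) q i) (sym (second-last q p i)))
    others
    where
    second-last : ∀ p q i → gram (f ▷ p ▷ q) i (inject₁ (Fin.fromℕ n)) ≡ L (λ x → x ^ᴰ toℕ i ⊛ p x)
    second-last p q i = trans (other-column (f ▷ p) q i (Fin.fromℕ n))
      (cong (λ r → L (λ x → x ^ᴰ toℕ i ⊛ r x)) (▷-last f p))
    earlier : ∀ p q i k → gram (f ▷ p ▷ q) i (inject₁ (inject₁ k)) ≡ L (λ x → x ^ᴰ toℕ i ⊛ f k x)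
    earlier p q i k = trans (other-column (f ▷ p) q i (inject₁ k))
      (cong (λ r → L (λ x → x ^ᴰ toℕ i ⊛ r x)) (▷-inject₁ f p k))
    others : ∀ i j → j ≢ inject₁ (Fin.fromℕ n) → j ≢ suc (Fin.fromℕ n) → gram (f ▷ p ▷ q) i j ≡ gram (f ▷ q ▷ p) i j
    others i j j≢n j≢1+n with view j
    ... | ‵fromℕ = contradiction refl j≢1+n
    ... | ‵inject₁ k with view k
    ...   | ‵fromℕ     = contradiction refl j≢n
    ...   | ‵inject₁ l = trans (earlier p q i l) (sym (earlier q p i l))

  Δ-last : ∀ {n} (f : Vector DualFunction n) p → (∀ i → i < n → L (λ x → x ^ᴰ i ⊛ p x) ≡ 0ℤ) →
    Δ f p ≡ L (λ x → x ^ᴰ n ⊛ p x) * det (gram f)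
  Δ-last {n} f p zeros = begin
    Δ f p
      ≡⟨ det-last-column (gram (f ▷ p)) (λ i → trans (last-column f p (inject₁ i)) (zeros _ (subst (_< n) (sym (toℕ-inject₁ i)) (toℕ<n i)))) ⟩
    gram (f ▷ p) (Fin.fromℕ n) (Fin.fromℕ n) * det {n} (λ i j → gram (f ▷ p) (inject₁ i) (inject₁ j))
      ≡⟨ cong₂ _*_ (trans (last-column f p (Fin.fromℕ n)) (cong (λ k → L (λ x → x ^ᴰ k ⊛ p x)) (toℕ-fromℕ n)))
           (det-cong λ i j → trans (other-column f p (inject₁ i) j) (cong (λ k → L (λ x → x ^ᴰ k ⊛ f j x)) (toℕ-inject₁ i))) ⟩
    L (λ x → x ^ᴰ n ⊛ p x) * det (gram f) ∎

  -- Indexed by size, whereas `H n` has size n + 1; odd sizes correspond to the even-indexed Hankel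
  -- determinants.
  D : ℕ → ℤ
  D n = det (gram (powers n))

  Δ-powers : ∀ n → Δ (powers n) (_^ᴰ n) ≡ D (suc n)
  Δ-powers n = gram-cong (powers-▷ n)

  Δ-powers-lower : ∀ n i → i < n → Δ (powers n) (_^ᴰ i) ≡ 0ℤ
  Δ-powers-lower n i i<n = trans
    (cong (λ k → Δ (powers n) (_^ᴰ k)) (sym (toℕ-fromℕ< i<n)))
    (Δ-repeat (powers n) (fromℕ< i<n))

  Δ-powers-▷-lower : ∀ n q i → i < n → Δ (powers n ▷ q) (_^ᴰ i) ≡ 0ℤ
  Δ-powers-▷-lower n q i i<n = trans
    (cong (Δ (powers n ▷ q)) (trans (cong (λ k x → x ^ᴰ k) (sym (toℕ-fromℕ< i<n))) (sym (▷-inject₁ (powers n) q (fromℕ< i<n)))))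
    (Δ-repeat (powers n ▷ q) (inject₁ (fromℕ< i<n)))

  -1^m²≡1 : ∀ m → -1ℤ ^ m * -1ℤ ^ m ≡ 1ℤ
  -1^m²≡1 zero    = refl
  -1^m²≡1 (suc m) = trans (square (-1ℤ ^ m)) (-1^m²≡1 m)
    where
    square : ∀ e → -1ℤ * e * (-1ℤ * e) ≡ e * e
    square = solve-∀

  -- The two-step recurrence for the determinants

  module _ (m : ℕ) where

    lead : ℤ
    lead = rise (1ℤ + + m) m * -1ℤ ^ m

    private
      Pₘ xPₘ : DualFunction
      Pₘ = P m 0
      xPₘ x = x ^ᴰ 1 ⊛ P m 0 x

      1* : ∀ (p : DualFunction) x → x ^ᴰ 0 ⊛ p x ≡ p x
      1* p x = CommutativeRing.*-identityˡ dualRing (p x)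

    leading : ∀ {ψ} (ψ-linear : IsLinear ψ) i → (∀ k → k < i ℕ.+ 2 ℕ.* m → ψ (_^ᴰ k) ≡ 0ℤ) →
      ψ (λ x → x ^ᴰ i ⊛ Pₘ x) ≡ lead * ψ (_^ᴰ (i ℕ.+ 2 ℕ.* m))
    leading {ψ} ψ-linear i lower = begin
      ψ (λ x → x ^ᴰ i ⊛ Pₘ x)
        ≡⟨ Leading.P-leading ψ-linear (i ℕ.+ 2 ℕ.* m) lower m 0 i (cong (λ k → i ℕ.+ 2 ℕ.* k) (ℕ.+-identityʳ m)) ⟩
      rise (1ℤ + + m + 0ℤ) m * (-1ℤ ^ (m ℕ.+ 0) * z)
        ≡⟨ cong₂ (λ y k → rise y m * (-1ℤ ^ k * z)) (ℤ.+-identityʳ (1ℤ + + m)) (ℕ.+-identityʳ m) ⟩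
      rise (1ℤ + + m) m * (-1ℤ ^ m * z)
        ≡⟨ ℤ.*-assoc (rise (1ℤ + + m) m) (-1ℤ ^ m) z ⟨
      lead * z ∎
      where z = ψ (_^ᴰ (i ℕ.+ 2 ℕ.* m))

    -- With P_m as last column even the corner entry vanishes, since P_m is orthogonal to x^{2m}.
    lead*D-odd : lead * D (suc (2 ℕ.* m)) ≡ 0ℤ
    lead*D-odd = begin
      lead * D (suc (2 ℕ.* m))
        ≡⟨ cong (lead *_) (Δ-powers (2 ℕ.* m)) ⟨
      lead * Δ (powers (2 ℕ.* m)) (_^ᴰ (2 ℕ.* m))
        ≡⟨ leading (Δ-isLinear (powers (2 ℕ.* m))) 0 (Δ-powers-lower (2 ℕ.* m)) ⟨
      Δ (powers (2 ℕ.* m)) (λ x → x ^ᴰ 0 ⊛ Pₘ x)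
        ≡⟨ respects (Δ-isLinear (powers (2 ℕ.* m))) (1* Pₘ) ⟩
      Δ (powers (2 ℕ.* m)) Pₘ
        ≡⟨ Δ-last (powers (2 ℕ.* m)) Pₘ (λ i i<2m → P-orthogonal m i (ℕ.m≤n⇒m≤1+n i<2m)) ⟩
      L (λ x → x ^ᴰ (2 ℕ.* m) ⊛ Pₘ x) * D (2 ℕ.* m)
        ≡⟨ cong (_* D (2 ℕ.* m)) (P-orthogonal m (2 ℕ.* m) ℕ.≤-refl) ⟩
      0ℤ * D (2 ℕ.* m)
        ≡⟨ ℤ.*-zeroˡ (D (2 ℕ.* m)) ⟩
      0ℤ ∎

    -- x^{2m+1} is replaced by x P_m while x^{2m} is still a column, because the lower terms of x
    -- P_m involve x^{2m}. The swap that brings x^{2m} to the end is the only source of the minus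
    -- sign. Both corner entries are `h m`, as the factor x can be moved from the column to the row.
    lead²*D-even : lead * (lead * D (suc (suc (2 ℕ.* m)))) ≡ - (h m * (h m * D (2 ℕ.* m)))
    lead²*D-even = begin
      lead * (lead * D (suc n))
        ≡⟨ cong (λ z → lead * (lead * z)) (Δ-powers n) ⟨
      lead * (lead * Δ (powers n) (_^ᴰ n))
        ≡⟨ cong (lead *_) (leading (Δ-isLinear (powers n)) 1 (Δ-powers-lower n)) ⟨
      lead * Δ (powers n) xPₘ
        ≡⟨ cong (lead *_) (gram-cong (▷-cong xPₘ (powers-▷ (2 ℕ.* m)))) ⟨
      lead * Δ (powers (2 ℕ.* m) ▷ (_^ᴰ (2 ℕ.* m))) xPₘ
        ≡⟨ cong (lead *_) (Δ-swap (powers (2 ℕ.* m)) (_^ᴰ (2 ℕ.* m)) xPₘ) ⟩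
      lead * - Δ (powers (2 ℕ.* m) ▷ xPₘ) (_^ᴰ (2 ℕ.* m))
        ≡⟨ ℤ.neg-distribʳ-* lead _ ⟨
      - (lead * Δ (powers (2 ℕ.* m) ▷ xPₘ) (_^ᴰ (2 ℕ.* m)))
        ≡⟨ cong -_ (leading (Δ-isLinear (powers (2 ℕ.* m) ▷ xPₘ)) 0 (Δ-powers-▷-lower (2 ℕ.* m) xPₘ)) ⟨
      - Δ (powers (2 ℕ.* m) ▷ xPₘ) (λ x → x ^ᴰ 0 ⊛ Pₘ x)
        ≡⟨ cong -_ (respects (Δ-isLinear (powers (2 ℕ.* m) ▷ xPₘ)) (1* Pₘ)) ⟩
      - Δ (powers (2 ℕ.* m) ▷ xPₘ) Pₘ
        ≡⟨ cong -_ (Δ-last (powers (2 ℕ.* m) ▷ xPₘ) Pₘ (P-orthogonal m)) ⟩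
      - (h m * Δ (powers (2 ℕ.* m)) xPₘ)
        ≡⟨ cong (λ z → - (h m * z)) (Δ-last (powers (2 ℕ.* m)) xPₘ λ i i<2m → trans (shift i) (P-orthogonal m (suc i) (s≤s i<2m))) ⟩
      - (h m * (L (λ x → x ^ᴰ (2 ℕ.* m) ⊛ xPₘ x) * D (2 ℕ.* m)))
        ≡⟨ cong (λ z → - (h m * (z * D (2 ℕ.* m)))) (shift (2 ℕ.* m)) ⟩
      - (h m * (h m * D (2 ℕ.* m))) ∎
      where
      n = suc (2 ℕ.* m)
      absorb : ∀ x y p → y ⊛ ((x ⊛ 𝟙) ⊛ p) ≡ x ⊛ y ⊛ p
      absorb = RingSolver.solve-∀ dualAlmostRing
      shift : ∀ i → L (λ x → x ^ᴰ i ⊛ xPₘ x) ≡ L (λ x → x ^ᴰ suc i ⊛ Pₘ x)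
      shift i = respects L-isLinear {λ x → x ^ᴰ i ⊛ xPₘ x} {λ x → x ^ᴰ suc i ⊛ Pₘ x} λ x → absorb x (x ^ᴰ i) (Pₘ x)

    numerator : ℤ
    numerator = W (+ s) m * W (- + s) m * F m (+ m)

    -- The first factor is the leading coefficient of P_m up to sign, the second the denominator of
    -- its norm.
    denominator : ℤ
    denominator = rise (1ℤ + + m) m * rise (1ℤ + + m) (suc m)

    -- `P-norm` is substituted into `lead²*D-even`; the signs (-1)^m occur only squared.
    D-recurrence : denominator * (denominator * D (suc (suc (2 ℕ.* m)))) ≡ - (+ s * + s) * (numerator * (numerator * D (2 ℕ.* m)))
    D-recurrence = begin
      r * R * (r * R * D₂)                       ≡⟨ insert-sign r R e D₂ (-1^m²≡1 m) ⟩
      R * R * (r * e * (r * e * D₂))             ≡⟨ cong (R * R *_) lead²*D-even ⟩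
      R * R * - (h m * (h m * D₀))               ≡⟨ regroup R (h m) D₀ ⟩
      - (R * h m * (R * h m * D₀))               ≡⟨ cong (λ z → - (z * (z * D₀))) (P-norm m) ⟩
      - (e * (+ s * N) * (e * (+ s * N) * D₀))   ≡⟨ remove-sign e (+ s) N D₀ (-1^m²≡1 m) ⟩
      - (+ s * + s) * (N * (N * D₀)) ∎
      where
      e = -1ℤ ^ m
      r = rise (1ℤ + + m) m
      R = rise (1ℤ + + m) (suc m)
      N = numerator
      D₀ = D (2 ℕ.* m)
      D₂ = D (suc (suc (2 ℕ.* m)))
      insert-sign : ∀ r R e d → e * e ≡ 1ℤ → r * R * (r * R * d) ≡ R * R * (r * e * (r * e * d))
      insert-sign r R e d e²≡1 = trans (sym (ℤ.*-identityˡ _)) (trans (cong (_* (r * R * (r * R * d))) (sym e²≡1)) (move r R e d))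
        where
        move : ∀ r R e d → e * e * (r * R * (r * R * d)) ≡ R * R * (r * e * (r * e * d))
        move = solve-∀
      remove-sign : ∀ e s N d → e * e ≡ 1ℤ → - (e * (s * N) * (e * (s * N) * d)) ≡ - (s * s) * (N * (N * d))
      remove-sign e s N d e²≡1 = trans (move e s N d) (trans (cong (_* (- (s * s) * (N * (N * d)))) e²≡1) (ℤ.*-identityˡ _))
        where
        move : ∀ e s N d → - (e * (s * N) * (e * (s * N) * d)) ≡ e * e * (- (s * s) * (N * (N * d)))
        move = solve-∀
      regroup : ∀ R h d → R * R * - (h * (h * d)) ≡ - (R * h * (R * h * d))
      regroup = solve-∀

  -- Growth and vanishing of the norms and determinants

  numerator-suc : ∀ m → numerator (suc m) ≡
    numerator m * ((1ℤ + + m) * (1ℤ + + m) * (1ℤ + + m) * (1ℤ + + m) * ((1ℤ + + m) * (1ℤ + + m) - + s * + s))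
  numerator-suc m = trans
    (cong (λ z → W (+ s) (suc m) * W (- + s) (suc m) * z) (F-suc m (+ m)))
    (regroup (+ s) (+ m) (W (+ s) m) (W (- + s) m) (F m (+ m)))
    where
    regroup : ∀ s m W W′ F →
      W * ((1ℤ + s + m) * (1ℤ + m)) * (W′ * ((1ℤ + - s + m) * (1ℤ + m))) * (F * ((1ℤ + m) * (1ℤ + m))) ≡
      W * W′ * F * ((1ℤ + m) * (1ℤ + m) * (1ℤ + m) * (1ℤ + m) * ((1ℤ + m) * (1ℤ + m) - s * s))
    regroup = solve-∀

  denominator-suc : ∀ m → denominator (suc m) ≡ denominator m * (+ 4 * (+ 3 + + m + + m) * (1ℤ + + m + + m))
  denominator-suc m = trans (cong (λ z → z * (z * (1ℤ + (1ℤ + + m) + (1ℤ + + m)))) r-suc) (regroup (+ m) r)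
    where
    r = rise (1ℤ + + m) m
    r-suc : rise (1ℤ + (1ℤ + + m)) (suc m) ≡ r * (+ 2 * (1ℤ + + m + + m))
    -- Multiplied by m + 1, both sides are the product of m + 1, ..., 2m + 2, whose last factor is 2
    -- (m + 1).
    r-suc = ℤ.*-cancelˡ-≡ (1ℤ + + m) _ _ (trans (sym (rise-shift (1ℤ + + m) (suc m))) (expand r (+ m)))
      where
      expand : ∀ r m → r * (1ℤ + m + m) * (1ℤ + m + (1ℤ + m)) ≡ (1ℤ + m) * (r * (+ 2 * (1ℤ + m + m)))
      expand = solve-∀
    regroup : ∀ m r → r * (+ 2 * (1ℤ + m + m)) * (r * (+ 2 * (1ℤ + m + m)) * (1ℤ + (1ℤ + m) + (1ℤ + m))) ≡
      r * (r * (1ℤ + m + m)) * (+ 4 * (+ 3 + m + m) * (1ℤ + m + m))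
    regroup = solve-∀

  denominator-cancel : ∀ m {x y} → denominator m * x ≡ denominator m * y → x ≡ y
  denominator-cancel m {x} {y} eq = rise-cancel m (suc m) (rise-cancel m m (begin
    r * (R * x) ≡⟨ ℤ.*-assoc r R x ⟨
    r * R * x   ≡⟨ eq ⟩
    r * R * y   ≡⟨ ℤ.*-assoc r R y ⟩
    r * (R * y) ∎))
    where
    r = rise (1ℤ + + m) m
    R = rise (1ℤ + + m) (suc m)

  -- The factor of index k contains 1 - (k + 1) + k = 0. For s = k + 1 this is the zero of s² - ℓ²
  -- at ℓ = s.
  W-zero : ∀ k m → k < m → W (- + suc k) m ≡ 0ℤ
  W-zero k (suc m) k<1+m with ℕ.m<1+n⇒m<n∨m≡n k<1+m
  ... | inj₁ k<m  = cong (_* ((1ℤ + - + suc k + + m) * (1ℤ + + m))) (W-zero k m k<m)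
  ... | inj₂ refl = factor-zero (+ m) (W (- + suc m) m)
    where
    factor-zero : ∀ m w → w * ((1ℤ + - (1ℤ + m) + m) * (1ℤ + m)) ≡ 0ℤ
    factor-zero = solve-∀

  D-odd : ∀ m → D (suc (2 ℕ.* m)) ≡ 0ℤ
  D-odd m = rise-cancel m m (begin
    r * D₁             ≡⟨ insert r e D₁ (-1^m²≡1 m) ⟩
    e * (r * e * D₁)   ≡⟨ cong (e *_) (lead*D-odd m) ⟩
    e * 0ℤ             ≡⟨ zeros e r ⟩
    r * 0ℤ ∎)
    where
    r = rise (1ℤ + + m) m
    e = -1ℤ ^ m
    D₁ = D (suc (2 ℕ.* m))
    zeros : ∀ e r → e * 0ℤ ≡ r * 0ℤ
    zeros = solve-∀
    insert : ∀ r e d → e * e ≡ 1ℤ → r * d ≡ e * (r * e * d)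
    insert r e d e²≡1 = trans (sym (ℤ.*-identityˡ _)) (trans (cong (_* (r * d)) (sym e²≡1)) (move r e d))
      where
      move : ∀ r e d → e * e * (r * d) ≡ e * (r * e * d)
      move = solve-∀

  D-even-zero : 1 ≤ s → ∀ m → s ≤ m → D (suc (suc (2 ℕ.* m))) ≡ 0ℤ
  D-even-zero 1≤s m s≤m = denominator-cancel m (denominator-cancel m (begin
    denominator m * (denominator m * D (suc (suc (2 ℕ.* m))))          ≡⟨ D-recurrence m ⟩
    - (+ s * + s) * (numerator m * (numerator m * D (2 ℕ.* m)))        ≡⟨ cong (λ z → - (+ s * + s) * (z * (z * D (2 ℕ.* m)))) (numerator-zero s 1≤s s≤m) ⟩
    - (+ s * + s) * (0ℤ * (0ℤ * D (2 ℕ.* m)))                          ≡⟨ zeros (+ s) (D (2 ℕ.* m)) (denominator m) ⟩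
    denominator m * (denominator m * 0ℤ) ∎))
    where
    zeros : ∀ s d r → - (s * s) * (0ℤ * (0ℤ * d)) ≡ r * (r * 0ℤ)
    zeros = solve-∀
    numerator-zero : ∀ t → 1 ≤ t → t ≤ m → W (+ t) m * W (- + t) m * F m (+ m) ≡ 0ℤ
    numerator-zero (suc k) _ k<m = trans (cong (λ z → W (+ suc k) m * z * F m (+ m)) (W-zero k m k<m)) (zeros′ (W (+ suc k) m) (F m (+ m)))
      where
      zeros′ : ∀ w f → w * 0ℤ * f ≡ 0ℤ
      zeros′ = solve-∀

-- From the integers to the rationals

module RationalTransfer where
  open import Data.Integer.Base using (-_; _+_; _*_; _^_)

  fromℤ : ℤ → ℚ
  fromℤ i = i / 1

  fromℚᵘ-homo-+ : ∀ p q → ℚ.fromℚᵘ (p ℚᵘ.+ q) ≡ ℚ.fromℚᵘ p ℚ.+ ℚ.fromℚᵘ q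
  fromℚᵘ-homo-+ p q = ℚ.toℚᵘ-injective (ℚᵘ.≃-trans (ℚ.toℚᵘ-fromℚᵘ (p ℚᵘ.+ q)) (ℚᵘ.≃-sym
    (ℚᵘ.≃-trans (ℚ.toℚᵘ-homo-+ (ℚ.fromℚᵘ p) (ℚ.fromℚᵘ q)) (ℚᵘ.+-cong (ℚ.toℚᵘ-fromℚᵘ p) (ℚ.toℚᵘ-fromℚᵘ q)))))

  fromℚᵘ-homo-* : ∀ p q → ℚ.fromℚᵘ (p ℚᵘ.* q) ≡ ℚ.fromℚᵘ p ℚ.* ℚ.fromℚᵘ q
  fromℚᵘ-homo-* p q = ℚ.toℚᵘ-injective (ℚᵘ.≃-trans (ℚ.toℚᵘ-fromℚᵘ (p ℚᵘ.* q)) (ℚᵘ.≃-sym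
    (ℚᵘ.≃-trans (ℚ.toℚᵘ-homo-* (ℚ.fromℚᵘ p) (ℚ.fromℚᵘ q)) (ℚᵘ.*-cong (ℚ.toℚᵘ-fromℚᵘ p) (ℚ.toℚᵘ-fromℚᵘ q)))))

  fromℤ-homo-+ : ∀ i j → fromℤ (i + j) ≡ fromℤ i ℚ.+ fromℤ j
  fromℤ-homo-+ i j = trans (cong fromℤ (sym (cong₂ _+_ (ℤ.*-identityʳ i) (ℤ.*-identityʳ j)))) (fromℚᵘ-homo-+ (mkℚᵘ i 0) (mkℚᵘ j 0))

  fromℤ-homo-* : ∀ i j → fromℤ (i * j) ≡ fromℤ i ℚ.* fromℤ j
  fromℤ-homo-* i j = fromℚᵘ-homo-* (mkℚᵘ i 0) (mkℚᵘ j 0)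

  fromℤ-homo-neg : ∀ i → fromℤ (- i) ≡ ℚ.- fromℤ i
  fromℤ-homo-neg i = ℚ.toℚᵘ-injective (ℚᵘ.≃-trans (ℚ.toℚᵘ-fromℚᵘ (mkℚᵘ (- i) 0)) (ℚᵘ.≃-sym
    (ℚᵘ.≃-trans (ℚ.toℚᵘ-homo‿- (fromℤ i)) (ℚᵘ.-‿cong (ℚ.toℚᵘ-fromℚᵘ (mkℚᵘ i 0))))))

  fromℤ-isRingHomomorphism : IsRingHomomorphism (CommutativeRing.rawRing ℤ.+-*-commutativeRing) (CommutativeRing.rawRing ℚ.+-*-commutativeRing) fromℤ
  fromℤ-isRingHomomorphism = record
    { isSemiringHomomorphism = record
      { isNearSemiringHomomorphism = record
        { +-isMonoidHomomorphism = record
          { isMagmaHomomorphism = record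
            { isRelHomomorphism = record { cong = cong fromℤ }
            ; homo = fromℤ-homo-+
            }
          ; ε-homo = refl
          }
        ; *-homo = fromℤ-homo-*
        }
      ; 1#-homo = refl
      }
    ; -‿homo = fromℤ-homo-neg
    }

  /-*-cancel : ∀ i n .{{_ : ℕ.NonZero n}} → (i / n) ℚ.* fromℤ (+ n) ≡ fromℤ i
  /-*-cancel i (suc n) = trans (sym (fromℚᵘ-homo-* (mkℚᵘ i n) (mkℚᵘ (+ suc n) 0)))
    (ℚ.fromℚᵘ-cong {mkℚᵘ i n ℚᵘ.* mkℚᵘ (+ suc n) 0} {mkℚᵘ i 0} (*≡* (cross i (+ suc n))))
    where
    cross : ∀ i d → i * d * 1ℤ ≡ i * (d * 1ℤ)
    cross = solve-∀

  rationalRing : AlmostCommutativeRing 0ℓ 0ℓ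
  rationalRing = fromCommutativeRing ℚ.+-*-commutativeRing λ _ → nothing

  fromℤ-cancel : ∀ n {x y} → fromℤ (+ suc n) ℚ.* x ≡ fromℤ (+ suc n) ℚ.* y → x ≡ y
  fromℤ-cancel n {x} {y} eq = begin
    x                                              ≡⟨ insert x ⟩
    (1ℤ / suc n) ℚ.* (fromℤ (+ suc n) ℚ.* x) ≡⟨ cong ((1ℤ / suc n) ℚ.*_) eq ⟩
    (1ℤ / suc n) ℚ.* (fromℤ (+ suc n) ℚ.* y) ≡⟨ insert y ⟨
    y ∎
    where
    insert : ∀ x → x ≡ (1ℤ / suc n) ℚ.* (fromℤ (+ suc n) ℚ.* x)
    insert x = begin
      x                                              ≡⟨ ℚ.*-identityˡ x ⟨
      1ℚ ℚ.* x                                       ≡⟨ cong (ℚ._* x) (/-*-cancel 1ℤ (suc n)) ⟨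
      (1ℤ / suc n) ℚ.* fromℤ (+ suc n) ℚ.* x         ≡⟨ ℚ.*-assoc (1ℤ / suc n) (fromℤ (+ suc n)) x ⟩
      (1ℤ / suc n) ℚ.* (fromℤ (+ suc n) ℚ.* x) ∎

  pos-^ : ∀ n k → + (n ℕ.^ k) ≡ (+ n) ^ k
  pos-^ n zero    = refl
  pos-^ n (suc k) = trans (ℤ.pos-* n (n ℕ.^ k)) (cong (λ z → + n * z) (pos-^ n k))

  module ∏ = CommutativeMonoidSum ℚ.*-1-commutativeMonoid

  ^ℚ-suc² : ∀ x e → x ^ℚ (2 ℕ.* suc e) ≡ x ^ℚ (2 ℕ.* e) ℚ.* (x ℚ.* x)
  ^ℚ-suc² x e = trans (cong (x ^ℚ_) (double e)) (rotate x (x ^ℚ (2 ℕ.* e)))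
    where
    double : ∀ e → 2 ℕ.* suc e ≡ 2 ℕ.+ 2 ℕ.* e
    double = ℕ-Solver.solve-∀
    rotate : ∀ x y → x ℚ.* (x ℚ.* y) ≡ y ℚ.* (x ℚ.* x)
    rotate = RingSolver.solve-∀ rationalRing

open RationalTransfer

-- Identification with the Hankel determinants of `S`

module Transfer (s : ℕ) where
  open import Data.Integer.Base using (-_; _+_; _*_; _-_; _^_)
  open SemiringSum (CommutativeRing.semiring ℤ.+-*-commutativeRing) using (sum; sum-cong-≗)
  open Moments s
  open Determinant (CommutativeRing.rawRing ℤ.+-*-commutativeRing) using (det)

  ^ᴰ-+ : ∀ x i j → x ^ᴰ i ⊛ x ^ᴰ j ≡ x ^ᴰ (i ℕ.+ j)
  ^ᴰ-+ x zero    j = CommutativeRing.*-identityˡ dualRing (x ^ᴰ j)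
  ^ᴰ-+ x (suc i) j = trans (CommutativeRing.*-assoc dualRing x (x ^ᴰ i) (x ^ᴰ j)) (cong (x ⊛_) (^ᴰ-+ x i j))

  re-node-^ : ∀ r k → Dual.re (node r ^ᴰ k) ≡ + (r ℕ.^ k)
  re-node-^ r zero    = refl
  re-node-^ r (suc k) = trans (cong (λ z → + r * z) (re-node-^ r k)) (sym (ℤ.pos-* r (r ℕ.^ k)))

  du-node-^ : ∀ r k → Dual.du (node r ^ᴰ suc k) ≡ + (suc k ℕ.* r ℕ.^ k)
  du-node-^ r zero    = cong (_+ 1ℤ) (ℤ.*-zeroʳ (+ r))
  du-node-^ r (suc k) = begin
    + r * Dual.du (node r ^ᴰ suc k) + 1ℤ * Dual.re (node r ^ᴰ suc k)
      ≡⟨ cong₂ (λ y z → + r * y + 1ℤ * z) (du-node-^ r k) (re-node-^ r (suc k)) ⟩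
    + r * + (suc k ℕ.* r ℕ.^ k) + 1ℤ * + (r ℕ.^ suc k)
      ≡⟨ cong₂ _+_ (sym (ℤ.pos-* r (suc k ℕ.* r ℕ.^ k))) (ℤ.*-identityˡ (+ (r ℕ.^ suc k))) ⟩
    + (r ℕ.* (suc k ℕ.* r ℕ.^ k) ℕ.+ r ℕ.* r ℕ.^ k)
      ≡⟨ cong +_ (collect r k (r ℕ.^ k)) ⟩
    + (suc (suc k) ℕ.* r ℕ.^ suc k) ∎
    where
    collect : ∀ r k z → r ℕ.* ((1 ℕ.+ k) ℕ.* z) ℕ.+ r ℕ.* z ≡ (2 ℕ.+ k) ℕ.* (r ℕ.* z)
    collect = ℕ-Solver.solve-∀

  L-power : ∀ k → L (_^ᴰ k) ≡ + S s k
  L-power zero    = sum-zeros s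
    where
    sum-zeros : ∀ n → sum {n} (λ _ → 0ℤ) ≡ 0ℤ
    sum-zeros zero    = refl
    sum-zeros (suc n) = trans (ℤ.+-identityˡ _) (sum-zeros n)
  L-power (suc k) = trans (sum-cong-≗ {s} λ i → du-node-^ (suc (toℕ i)) k) (pos-sum s (λ i → suc (toℕ i) ℕ.^ k))
    where
    pos-sum : ∀ n (g : Fin n → ℕ) → sum {n} (λ i → + (suc k ℕ.* g i)) ≡ + (suc k ℕ.* RawSemiringDefs.sum ℕ.+-*-rawSemiring g)
    pos-sum zero    g = cong +_ (sym (ℕ.*-zeroʳ (suc k)))
    pos-sum (suc n) g = trans (cong (λ z → + (suc k ℕ.* g zero) + z) (pos-sum n (g ∘ suc)))
      (cong +_ (sym (ℕ.*-distribˡ-+ (suc k) (g zero) _)))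

  H-fromℤ : ∀ n → H n (λ k → fromℕ (S s k)) ≡ fromℤ (D (suc n))
  H-fromℤ n = begin
    H n (λ k → fromℕ (S s k))
      ≡⟨ det-homo {suc n} (λ i j → + S s (toℕ i ℕ.+ toℕ j)) ⟨
    fromℤ (det {suc n} λ i j → + S s (toℕ i ℕ.+ toℕ j))
      ≡⟨ cong fromℤ (det-cong {suc n} {λ i j → + S s (toℕ i ℕ.+ toℕ j)} {gram (powers (suc n))} λ i j → sym (entry (toℕ i) (toℕ j))) ⟩
    fromℤ (D (suc n)) ∎
    where
    open DeterminantHomomorphism ℤ.+-*-commutativeRing ℚ.+-*-commutativeRing fromℤ-isRingHomomorphism
    open DeterminantProperties ℤ.+-*-commutativeRing using (det-cong)
    entry : ∀ i j → L (λ x → x ^ᴰ i ⊛ x ^ᴰ j) ≡ + S s (i ℕ.+ j)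
    entry i j = trans
      (IsLinear.respects L-isLinear {λ x → x ^ᴰ i ⊛ x ^ᴰ j} {λ x → x ^ᴰ (i ℕ.+ j)} λ x → ^ᴰ-+ x i j)
      (L-power (i ℕ.+ j))

  -- Introduced because passing from `D (2 * m)` to the next even size multiplies by - s² times the
  -- square of this partial product.
  φ : ℕ → ℚ
  φ m = ∏ {m} λ i → factor s (suc (toℕ i))

  φ-suc : ∀ m → φ (suc m) ≡ φ m ℚ.* factor s (suc m)
  φ-suc m = trans (∏.sum-init-last {m} (λ i → factor s (suc (toℕ i))))
    (cong₂ ℚ._*_ (∏.sum-cong-≗ {m} λ i → cong (λ k → factor s (suc k)) (toℕ-inject₁ i))
                 (cong (λ k → factor s (suc k)) (toℕ-fromℕ m)))

  factor-value : ∀ m → factor s (suc m) ℚ.* fromℤ (+ 4 * (+ 3 + + m + + m) * (1ℤ + + m + + m)) ≡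
    fromℤ (- ((1ℤ + + m) * (1ℤ + + m) * (1ℤ + + m) * (1ℤ + + m) * ((1ℤ + + m) * (1ℤ + + m) - + s * + s)))
  factor-value m = begin
    factor s (suc m) ℚ.* fromℤ (+ 4 * (+ 3 + + m + + m) * (1ℤ + + m + + m))
      ≡⟨ cong (λ z → factor s (suc m) ℚ.* fromℤ z) denominators ⟨
    factor s (suc m) ℚ.* fromℤ (+ (4 ℕ.* (2 ℕ.* suc m ℕ.+ 1) ℕ.* (2 ℕ.* suc m ℕ.∸ 1)))
      ≡⟨ /-*-cancel (+ (suc m ℕ.^ 4) * (+ (s ℕ.^ 2) - + (suc m ℕ.^ 2))) (4 ℕ.* (2 ℕ.* suc m ℕ.+ 1) ℕ.* (2 ℕ.* suc m ℕ.∸ 1)) {{denominator≢0 (suc m)}} ⟩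
    fromℤ (+ (suc m ℕ.^ 4) * (+ (s ℕ.^ 2) - + (suc m ℕ.^ 2)))
      ≡⟨ cong fromℤ (trans
           (cong₂ _*_ (pos-^ (suc m) 4) (cong₂ _-_ (pos-^ s 2) (pos-^ (suc m) 2)))
           (expand (+ suc m) (+ s))) ⟩
    fromℤ (- ((1ℤ + + m) * (1ℤ + + m) * (1ℤ + + m) * (1ℤ + + m) * ((1ℤ + + m) * (1ℤ + + m) - + s * + s))) ∎
    where
    expand : ∀ n s → n * (n * (n * (n * 1ℤ))) * (s * (s * 1ℤ) - n * (n * 1ℤ)) ≡ - (n * n * n * n * (n * n - s * s))
    expand = solve-∀
    ℕ-denominators : ∀ m → 4 ℕ.* (2 ℕ.* (1 ℕ.+ m) ℕ.+ 1) ℕ.* (m ℕ.+ (1 ℕ.+ (m ℕ.+ 0))) ≡ 4 ℕ.* (3 ℕ.+ m ℕ.+ m) ℕ.* (1 ℕ.+ m ℕ.+ m)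
    ℕ-denominators = ℕ-Solver.solve-∀
    denominators : + (4 ℕ.* (2 ℕ.* suc m ℕ.+ 1) ℕ.* (2 ℕ.* suc m ℕ.∸ 1)) ≡ + 4 * (+ 3 + + m + + m) * (1ℤ + + m + + m)
    denominators = trans (cong +_ (ℕ-denominators m)) (trans
      (ℤ.pos-* (4 ℕ.* (3 ℕ.+ m ℕ.+ m)) (1 ℕ.+ m ℕ.+ m))
      (cong (_* (1ℤ + + m + + m)) (ℤ.pos-* 4 (3 ℕ.+ m ℕ.+ m))))

  -- `numerator` is built from ℓ² - s² and `factor` from s² - ℓ²; hence the sign, which disappears
  -- once `φ` is squared.
  φ-value : ∀ m → fromℤ (denominator m) ℚ.* φ m ≡ fromℤ (-1ℤ ^ m * numerator m)
  φ-value zero    = refl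
  φ-value (suc m) = begin
    fromℤ (denominator (suc m)) ℚ.* φ (suc m)
      ≡⟨ cong₂ ℚ._*_ (trans (cong fromℤ (denominator-suc m)) (fromℤ-homo-* (denominator m) d)) (φ-suc m) ⟩
    fromℤ (denominator m) ℚ.* fromℤ d ℚ.* (φ m ℚ.* factor s (suc m))
      ≡⟨ interchange (fromℤ (denominator m)) (fromℤ d) (φ m) (factor s (suc m)) ⟩
    fromℤ (denominator m) ℚ.* φ m ℚ.* (factor s (suc m) ℚ.* fromℤ d)
      ≡⟨ cong₂ ℚ._*_ (φ-value m) (factor-value m) ⟩
    fromℤ (-1ℤ ^ m * numerator m) ℚ.* fromℤ (- n)
      ≡⟨ fromℤ-homo-* (-1ℤ ^ m * numerator m) (- n) ⟨
    fromℤ (-1ℤ ^ m * numerator m * - n)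
      ≡⟨ cong fromℤ (trans (signs (-1ℤ ^ m) (numerator m) n) (cong (-1ℤ ^ suc m *_) (sym (numerator-suc m)))) ⟩
    fromℤ (-1ℤ ^ suc m * numerator (suc m)) ∎
    where
    d = + 4 * (+ 3 + + m + + m) * (1ℤ + + m + + m)
    n = (1ℤ + + m) * (1ℤ + + m) * (1ℤ + + m) * (1ℤ + + m) * ((1ℤ + + m) * (1ℤ + + m) - + s * + s)
    interchange : ∀ a b c e → a ℚ.* b ℚ.* (c ℚ.* e) ≡ a ℚ.* c ℚ.* (e ℚ.* b)
    interchange = RingSolver.solve-∀ rationalRing
    signs : ∀ e N n → e * N * - n ≡ -1ℤ * e * (N * n)
    signs = solve-∀

  denominator-positive : ∀ m → ∃ λ c → denominator m ≡ + suc c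
  denominator-positive m with c , eq ← rise-nonZero m m | c′ , eq′ ← rise-nonZero m (suc m) = _ , cong₂ _*_ eq eq′

  D-ratio : ∀ m → fromℤ (D (suc (suc (2 ℕ.* m)))) ≡ (ℚ.- fromℕ (s ℕ.^ 2)) ℚ.* (φ m ℚ.* φ m) ℚ.* fromℤ (D (2 ℕ.* m))
  D-ratio m = cancel (cancel (begin
    q d ℚ.* (q d ℚ.* q D₂)
      ≡⟨ trans (fromℤ-homo-* d (d * D₂)) (cong (q d ℚ.*_) (fromℤ-homo-* d D₂)) ⟨
    q (d * (d * D₂))
      ≡⟨ cong q (D-recurrence m) ⟩
    q (- (+ s * + s) * (N * (N * D₀)))
      ≡⟨ cong q (signs (+ s * + s) N D₀ (-1ℤ ^ m) (-1^m²≡1 m)) ⟩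
    q (- (+ s * + s) * (-1ℤ ^ m * N * (-1ℤ ^ m * N) * D₀))
      ≡⟨ trans (fromℤ-homo-* (- (+ s * + s)) (-1ℤ ^ m * N * (-1ℤ ^ m * N) * D₀)) (cong₂ ℚ._*_ (trans (fromℤ-homo-neg (+ s * + s)) (cong (λ z → ℚ.- q z) square))
           (trans (fromℤ-homo-* (-1ℤ ^ m * N * (-1ℤ ^ m * N)) D₀) (cong (ℚ._* q D₀) (fromℤ-homo-* (-1ℤ ^ m * N) (-1ℤ ^ m * N))))) ⟩
    c ℚ.* (q (-1ℤ ^ m * N) ℚ.* q (-1ℤ ^ m * N) ℚ.* q D₀)
      ≡⟨ cong (λ z → c ℚ.* (z ℚ.* z ℚ.* q D₀)) (φ-value m) ⟨
    c ℚ.* (q d ℚ.* φ m ℚ.* (q d ℚ.* φ m) ℚ.* q D₀)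
      ≡⟨ regroup c (q d) (φ m) (q D₀) ⟩
    q d ℚ.* (q d ℚ.* (c ℚ.* (φ m ℚ.* φ m) ℚ.* q D₀)) ∎))
    where
    q = fromℤ
    d = denominator m
    N = numerator m
    D₀ = D (2 ℕ.* m)
    D₂ = D (suc (suc (2 ℕ.* m)))
    c = ℚ.- fromℕ (s ℕ.^ 2)
    cancel : ∀ {x y} → q d ℚ.* x ≡ q d ℚ.* y → x ≡ y
    cancel eq with k , d≡k ← denominator-positive m = fromℤ-cancel k (subst (λ z → q z ℚ.* _ ≡ q z ℚ.* _) d≡k eq)
    square : + s * + s ≡ + (s ℕ.^ 2)
    square = sym (trans (pos-^ s 2) (cong (λ z → + s * z) (ℤ.*-identityʳ (+ s))))
    signs : ∀ t N D e → e * e ≡ 1ℤ → - t * (N * (N * D)) ≡ - t * (e * N * (e * N) * D)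
    signs t N D e e²≡1 = sym (trans (move t N D e) (trans (cong (_* (- t * (N * (N * D)))) e²≡1) (ℤ.*-identityˡ _)))
      where
      move : ∀ t N D e → - t * (e * N * (e * N) * D) ≡ e * e * (- t * (N * (N * D)))
      move = solve-∀
    regroup : ∀ c d f D → c ℚ.* (d ℚ.* f ℚ.* (d ℚ.* f) ℚ.* D) ≡ d ℚ.* (d ℚ.* (c ℚ.* (f ℚ.* f) ℚ.* D))
    regroup = RingSolver.solve-∀ rationalRing

  -- The closed form as a product of two-step ratios

  closed-form : ℕ → ℚ
  closed-form m = (ℚ.- fromℕ (s ℕ.^ 2)) ^ℚ (m ℕ.+ 1)
    ℚ.* ∏ {m} (λ i → factor s (suc (toℕ i)) ^ℚ (2 ℕ.* (m ℕ.+ 1 ℕ.∸ suc (toℕ i))))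

  -- The factor of index ℓ occurs once in each of `φ ℓ`, ..., `φ m`, that is m + 1 - ℓ times.
  -- Raising m adds one more square of each old factor and a first square of the new one.
  closed-form-suc : ∀ m → closed-form (suc m) ≡ (ℚ.- fromℕ (s ℕ.^ 2)) ℚ.* (φ (suc m) ℚ.* φ (suc m)) ℚ.* closed-form m
  closed-form-suc m = begin
    c ℚ.* c^ ℚ.* ∏ {suc m} new
      ≡⟨ cong (c ℚ.* c^ ℚ.*_) (∏.sum-init-last {m} new) ⟩
    c ℚ.* c^ ℚ.* (∏ {m} (λ i → new (inject₁ i)) ℚ.* new (Fin.fromℕ m))
      ≡⟨ cong (c ℚ.* c^ ℚ.*_) (cong₂ ℚ._*_ (trans (∏.sum-cong-≗ {m} new-init) products) new-last) ⟩
    c ℚ.* c^ ℚ.* (∏ old ℚ.* (φ m ℚ.* φ m) ℚ.* (g ℚ.* g))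
      ≡⟨ regroup c c^ (∏ old) (φ m) g ⟩
    c ℚ.* (φ m ℚ.* g ℚ.* (φ m ℚ.* g)) ℚ.* (c^ ℚ.* ∏ old)
      ≡⟨ cong (λ z → c ℚ.* (z ℚ.* z) ℚ.* (c^ ℚ.* ∏ old)) (φ-suc m) ⟨
    c ℚ.* (φ (suc m) ℚ.* φ (suc m)) ℚ.* closed-form m ∎
    where
    c = ℚ.- fromℕ (s ℕ.^ 2)
    c^ = c ^ℚ (m ℕ.+ 1)
    g = factor s (suc m)
    old : Fin m → ℚ
    old i = factor s (suc (toℕ i)) ^ℚ (2 ℕ.* (m ℕ.+ 1 ℕ.∸ suc (toℕ i)))
    new : Fin (suc m) → ℚ
    new i = factor s (suc (toℕ i)) ^ℚ (2 ℕ.* (suc m ℕ.+ 1 ℕ.∸ suc (toℕ i)))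
    square : Fin m → ℚ
    square i = factor s (suc (toℕ i)) ℚ.* factor s (suc (toℕ i))
    new-init : ∀ i → new (inject₁ i) ≡ old i ℚ.* square i
    new-init i = begin
      new (inject₁ i)
        ≡⟨ cong (λ k → factor s (suc k) ^ℚ (2 ℕ.* (suc m ℕ.+ 1 ℕ.∸ suc k))) (toℕ-inject₁ i) ⟩
      factor s (suc (toℕ i)) ^ℚ (2 ℕ.* (m ℕ.+ 1 ℕ.∸ toℕ i))
        -- Since `toℕ i` is below m, the truncated difference is a true one and is one larger than
        -- the old exponent count.
        ≡⟨ cong (λ e → factor s (suc (toℕ i)) ^ℚ (2 ℕ.* e)) (ℕ.+-∸-assoc 1 (ℕ.≤-trans (toℕ<n i) (ℕ.m≤m+n m 1))) ⟩
      factor s (suc (toℕ i)) ^ℚ (2 ℕ.* suc (m ℕ.+ 1 ℕ.∸ suc (toℕ i)))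
        ≡⟨ ^ℚ-suc² (factor s (suc (toℕ i))) (m ℕ.+ 1 ℕ.∸ suc (toℕ i)) ⟩
      old i ℚ.* square i ∎
    new-last : new (Fin.fromℕ m) ≡ g ℚ.* g
    new-last = begin
      new (Fin.fromℕ m)
        ≡⟨ cong (λ k → factor s (suc k) ^ℚ (2 ℕ.* (suc m ℕ.+ 1 ℕ.∸ suc k))) (toℕ-fromℕ m) ⟩
      g ^ℚ (2 ℕ.* (m ℕ.+ 1 ℕ.∸ m))
        ≡⟨ cong (λ e → g ^ℚ (2 ℕ.* e)) (ℕ.m+n∸m≡n m 1) ⟩
      g ℚ.* (g ℚ.* 1ℚ)
        ≡⟨ cong (g ℚ.*_) (ℚ.*-identityʳ g) ⟩
      g ℚ.* g ∎
    products : ∏ (λ i → old i ℚ.* square i) ≡ ∏ old ℚ.* (φ m ℚ.* φ m)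
    products = trans (∏.∑-distrib-+ {m} old square)
      (cong (∏ old ℚ.*_) (∏.∑-distrib-+ {m} (λ i → factor s (suc (toℕ i))) (λ i → factor s (suc (toℕ i)))))
    regroup : ∀ c p o f g → c ℚ.* p ℚ.* (o ℚ.* (f ℚ.* f) ℚ.* (g ℚ.* g)) ≡ c ℚ.* (f ℚ.* g ℚ.* (f ℚ.* g)) ℚ.* (p ℚ.* o)
    regroup = RingSolver.solve-∀ rationalRing

  D-closed-form : ∀ m → fromℤ (D (suc (suc (2 ℕ.* m)))) ≡ closed-form m
  -- `D 0` is the empty determinant, with value 1, and `φ 0` is an empty product.
  D-closed-form zero    = trans (D-ratio 0) (simplify (ℚ.- fromℕ (s ℕ.^ 2)))
    where
    simplify : ∀ c → c ℚ.* (1ℚ ℚ.* 1ℚ) ℚ.* 1ℚ ≡ c ℚ.* 1ℚ ℚ.* 1ℚ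
    simplify c = refl
  D-closed-form (suc m) = begin
    fromℤ (D (suc (suc (2 ℕ.* suc m))))
      ≡⟨ D-ratio (suc m) ⟩
    c ℚ.* (φ (suc m) ℚ.* φ (suc m)) ℚ.* fromℤ (D (2 ℕ.* suc m))
      ≡⟨ cong (λ n → c ℚ.* (φ (suc m) ℚ.* φ (suc m)) ℚ.* fromℤ (D n)) (double m) ⟩
    c ℚ.* (φ (suc m) ℚ.* φ (suc m)) ℚ.* fromℤ (D (suc (suc (2 ℕ.* m))))
      ≡⟨ cong (c ℚ.* (φ (suc m) ℚ.* φ (suc m)) ℚ.*_) (D-closed-form m) ⟩
    c ℚ.* (φ (suc m) ℚ.* φ (suc m)) ℚ.* closed-form m
      ≡⟨ closed-form-suc m ⟨
    closed-form (suc m) ∎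
    where
    c = ℚ.- fromℕ (s ℕ.^ 2)
    double : ∀ m → 2 ℕ.* suc m ≡ 2 ℕ.+ 2 ℕ.* m
    double = ℕ-Solver.solve-∀

  H-odd : ∀ m → H (2 ℕ.* m ℕ.+ 1) (λ k → fromℕ (S s k)) ≡ fromℤ (D (suc (suc (2 ℕ.* m))))
  H-odd m = trans (H-fromℤ (2 ℕ.* m ℕ.+ 1)) (cong (λ n → fromℤ (D (suc n))) (ℕ.+-comm (2 ℕ.* m) 1))

open import Data.Nat.Base using (_+_; _*_; _∸_; _^_)

corollary3p7 : (s : ℕ) → 1 ≤ s → (m : ℕ) →
    H (2 * m) (λ k → fromℕ (S s k)) ≡ 0ℚ
    × H (2 * m + 1) (λ k → fromℕ (S s k))
    ≡ (ℚ.- fromℕ (s ^ 2)) ^ℚ (m + 1)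
    ℚ.* ∏ {m} (λ i → factor s (suc (toℕ i)) ^ℚ (2 * (m + 1 ∸ suc (toℕ i))))
    × (s ≤ m → H (2 * m + 1) (λ k → fromℕ (S s k)) ≡ 0ℚ)
corollary3p7 s 1≤s m =
    trans (H-fromℤ (2 * m)) (cong fromℤ (D-odd m))
  , trans (H-odd m) (D-closed-form m)
  , λ s≤m → trans (H-odd m) (cong fromℤ (D-even-zero 1≤s m s≤m))
  where
  open Moments s
  open Transfer s
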